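{- Let $f(X)=a_nX^n+\cdots+a_1X+a_0$ be a polynomial with real coefficients, with $n\ge 1$ and $a_n>0$. Denote by $j_1<j_2<\cdots<j_\ell$ the indices $j$ for which $a_j<0$, and by $k_1<k_2<\cdots<k_t=n$ the indices $k>j_\ell$ for which $a_k>0$. Assume that $t\ge 2$ and let $$v=\max\left\{1,\ \max_{1\le i\le \ell}\left(\frac{|a_{j_1}+a_{j_2}+\cdots+a_{j_\ell}|}{a_{k_1}+a_{k_2}+\cdots+a_{k_t}}\right)^{\frac{1}{k_1-j_i}}\right\}.$$ Then $f$ has no zero in the sector $S_{v,\frac{\pi}{n}}$.
   Context: For real numbers $v,\theta$ with $0<\theta\le\pi$, define the open sector $S_{v,\theta}=\{z=v+\rho e^{i\varphi}\in\mathbb{C}:\rho>0,\ |\varphi|<\theta\}$ (with $\varphi$ real). If $f$ has no negative coefficients ($\ell=0$), the condition $k>j_\ell$ is void and the inner maximum over the empty set is understood to be $0$, i.e. $v=1$. -}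

module Defs where

open import Axiom.ExcludedMiddle using (ExcludedMiddle)
open import Algebra.Bundles using (CommutativeRing; Semiring)
open import Algebra.Bundles.Raw using (RawRing)
import Algebra.Construct.NaturalChoice.Max as NaturalMax
import Algebra.Definitions.RawSemiring as RawSemiringDefinitions
open import Data.Fin.Base as Fin using (Fin; toℕ)
import Data.Fin.Properties as Fin
open import Data.List.Base using (List; []; _∷_; allFin; filter; foldr; last; map)
import Data.List.Extrema as Extrema
import Data.Maybe.Relation.Unary.All as Maybe
open import Data.Nat.Base as ℕ using (ℕ; suc; _∸_; _!)
open import Data.Product.Base using (_×_; _,_; proj₁; ∃; ∃₂)
open import Data.Vec.Functional using (Vector)
open import Level using (0ℓ) renaming (suc to lsuc)
open import Relation.Binary.Bundles using (StrictTotalOrder)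
open import Relation.Binary.Core using (Rel)
import Relation.Binary.Properties.StrictTotalOrder as StrictTotalOrderProperties
open import Relation.Binary.Structures using (IsStrictTotalOrder)
open import Relation.Nullary.Decidable using (yes; no; _×-dec_)
open import Relation.Unary using (Pred; Satisfiable)

-- The library has no real numbers.  They are presented axiomatically: a
-- complete ordered field is, classically, unique up to unique isomorphism.
record CompleteOrderedField : Set (lsuc 0ℓ) where
  infix 4 _<_
  field
    commutativeRing : CommutativeRing 0ℓ 0ℓ

  open CommutativeRing commutativeRing public

  field
    _<_                : Rel Carrier 0ℓ
    isStrictTotalOrder : IsStrictTotalOrder _≈_ _<_
    0≉1                : 0# ≉ 1#
    invertible         : ∀ x → x ≉ 0# → ∃ λ y → x * y ≈ 1#
    +-monoˡ-<          : ∀ z {x y} → x < y → x + z < y + z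
    *-positive         : ∀ {x y} → 0# < x → 0# < y → 0# < x * y

  strictTotalOrder : StrictTotalOrder 0ℓ 0ℓ 0ℓ
  strictTotalOrder = record { isStrictTotalOrder = isStrictTotalOrder }

  open StrictTotalOrder strictTotalOrder public using (_<?_)
  open StrictTotalOrderProperties strictTotalOrder public
    using (_≤_; totalOrder)

  UpperBound : Pred Carrier 0ℓ → Pred Carrier 0ℓ
  UpperBound P u = ∀ {x} → P x → x ≤ u

  field
    complete : (P : Pred Carrier 0ℓ) → Satisfiable P → Satisfiable (UpperBound P) →
               ∃ λ s → UpperBound P s × (∀ {u} → UpperBound P u → s ≤ u)

module Analysis (em : ExcludedMiddle 0ℓ) (R : CompleteOrderedField) where

  open CompleteOrderedField R public
    renaming (Carrier to ℝ)
  open RawSemiringDefinitions (Semiring.rawSemiring semiring) public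
    using (_^_; sum) renaming (_×_ to _·_)
  open NaturalMax totalOrder public using (_⊔_)
  open Extrema totalOrder public using (max)

  infixl 7 _/_
  infix  8 _⁻¹
  infix  4 _⟶_

  -- Definite description: every P below (with m ≥ 1 in `root`) determines x up
  -- to _≈_.  The value is 0# when nothing satisfies P.
  the : Pred ℝ 0ℓ → ℝ
  the P with em {∃ P}
  ... | yes (x , _) = x
  ... | no  _       = 0#

  natural : ℕ → ℝ
  natural n = n · 1#

  _⁻¹ : ℝ → ℝ
  x ⁻¹ = the λ y → x * y ≈ 1#

  _/_ : ℝ → ℝ → ℝ
  x / y = x * y ⁻¹

  ∣_∣ : ℝ → ℝ
  ∣ x ∣ = x ⊔ - x

  root : ℕ → ℝ → ℝ
  root m x = the λ y → 0# ≤ y × y ^ m ≈ x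

  _⟶_ : (ℕ → ℝ) → ℝ → Set
  x ⟶ l = ∀ ε → 0# < ε → ∃ λ N → ∀ m → N ℕ.≤ m → ∣ x m - l ∣ < ε

  lim : (ℕ → ℝ) → ℝ
  lim x = the (x ⟶_)

  record ℂ : Set where
    constructor _+i_
    field
      re im : ℝ
  open ℂ public

  ℂ-rawRing : RawRing 0ℓ 0ℓ
  ℂ-rawRing = record
    { Carrier = ℂ
    ; _≈_     = λ z w → re z ≈ re w × im z ≈ im w
    ; _+_     = λ z w → (re z + re w) +i (im z + im w)
    ; _*_     = λ z w → (re z * re w - im z * im w) +i (re z * im w + im z * re w)
    ; -_      = λ z → (- re z) +i (- im z)
    ; 0#      = 0# +i 0#
    ; 1#      = 1# +i 0#
    }

  open RawRing ℂ-rawRing public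
    using ()
    renaming (_≈_ to _≈ᶜ_; _≉_ to _≉ᶜ_; _+_ to _+ᶜ_; _*_ to _*ᶜ_; 0# to 0ᶜ)
  open RawSemiringDefinitions (RawRing.rawSemiring ℂ-rawRing) public
    using () renaming (_^_ to _^ᶜ_; sum to sumᶜ)

  ι : ℝ → ℂ
  ι x = x +i 0#

  exp : ℂ → ℂ
  exp z = lim (λ N → re (partialSum N)) +i lim (λ N → im (partialSum N))
    where
    partialSum : ℕ → ℂ
    partialSum N = sumᶜ {N} λ k → ι (natural (toℕ k !) ⁻¹) *ᶜ z ^ᶜ toℕ k

  cis : ℝ → ℂ
  cis φ = exp (0# +i φ)

  cos : ℝ → ℝ
  cos φ = re (cis φ)

  -- π/2 is the least positive zero of cos.
  π : ℝ
  π = natural 2 * the λ h →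
    0# < h × cos h ≈ 0# × (∀ x → 0# < x → x < h → cos x ≉ 0#)

  Sector : ℝ → ℝ → Pred ℂ 0ℓ
  Sector v θ z = ∃₂ λ ρ φ → 0# < ρ × ∣ φ ∣ < θ × z ≈ᶜ ι v +ᶜ ι ρ *ᶜ cis φ

  -- Coefficients a₀ , … , aₙ in this order.
  Polynomial : ℕ → Set
  Polynomial n = Vector ℝ (suc n)

  eval : ∀ {n} → Polynomial n → ℂ → ℂ
  eval a z = sumᶜ λ k → ι (a k) *ᶜ z ^ᶜ toℕ k

  -- j₁ < ⋯ < j_ℓ
  negatives : ∀ {n} → Polynomial n → List (Fin (suc n))
  negatives {n} a = filter (λ j → a j <? 0#) (allFin (suc n))

  -- k₁ < ⋯ < k_t; the condition k > j_ℓ is void if there is no j_ℓ.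
  positives : ∀ {n} → Polynomial n → List (Fin (suc n))
  positives {n} a = filter
    (λ k → Maybe.dec (Fin._<? k) (last (negatives a)) ×-dec 0# <? a k)
    (allFin (suc n))

  sumOver : ∀ {n} → Polynomial n → List (Fin (suc n)) → ℝ
  sumOver a is = foldr _+_ 0# (map a is)

  -- `max 0#` serves as the maximum of a possibly empty list of nonnegative
  -- numbers.  The first equation is never used when the leading coefficient is
  -- positive.
  vertex : ∀ {n} → Polynomial n → ℝ
  vertex a with positives a
  ... | []           = 1#
  ... | ks@(k₁ ∷ _) = 1# ⊔ max 0# (map radius js)
    where
    js = negatives a
    radius = λ j → root (toℕ k₁ ∸ toℕ j) (∣ sumOver a js ∣ / sumOver a ks)

module Submission where

-- Write z = v + w with w = ρ e^(iφ), ∣ φ ∣ < π / n.  There is a real linear form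
-- on ℂ (Im, Re or - Im according to the sign of φ) that is nonnegative on
-- 1, w, …, wⁿ and positive on wⁿ.  Expanding z ^ m = (v + w) ^ m step by step shows
-- that its values h m at z ^ m satisfy h 0 ≥ 0, h (m + 1) ≥ v h m for m < n, and
-- h (n - 1) < h n.  With S⁻ and S⁺ the sums of the coefficients with indices jᵢ and
-- kᵢ, it follows as k₁ < n that
--   ∑ aₘ h m > S⁺ h k₁ + S⁻ h j_ℓ ≥ (S⁺ v^(k₁ - j_ℓ) - ∣ S⁻ ∣) h j_ℓ ≥ 0,
-- and the left-hand side is the value of the form at f(z).
--
-- That the form is as claimed amounts to sin x > 0 for 0 < x < π, which follows by
-- repeated halving, sin 2x = 2 sin x cos x, from sin x > 0 for small x and
-- cos x > 0 for 0 ≤ x < π / 2.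

open import Defs
open import Axiom.ExcludedMiddle using (ExcludedMiddle)
open import Data.Fin.Base using (fromℕ)
open import Data.List.Base using (length)
open import Data.Nat.Base as ℕ using (ℕ)
open import Level using (0ℓ)

open import Algebra.Bundles using (CommutativeRing; Semiring)
import Algebra.Construct.NaturalChoice.Max as NaturalMax
import Algebra.Construct.NaturalChoice.MaxOp as MaxOp
import Algebra.Definitions.RawSemiring as RawSemiringDefinitions
import Algebra.Properties.AbelianGroup as AbelianGroupProperties
import Algebra.Properties.CommutativeSemiring.Exp as CommutativeSemiringExp
import Algebra.Properties.Ring as RingProperties
import Algebra.Properties.Semiring.Exp as SemiringExp
import Algebra.Properties.Semiring.Mult as SemiringMult
import Algebra.Properties.Semiring.Mult.TCOptimised as SemiringMultTCOptimised
import Algebra.Properties.Semiring.Sum as SemiringSum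
import Algebra.Solver.Ring as RingSolver
open import Algebra.Solver.Ring.AlmostCommutativeRing
  using (fromCommutativeRing; _-Raw-AlmostCommutative⟶_)
open import Data.Bool.Base using (if_then_else_)
open import Data.Empty using (⊥; ⊥-elim)
open import Data.Fin.Base as Fin using (Fin; toℕ)
import Data.Fin.Properties as Fin
open import Data.Integer.Base as ℤ using (ℤ; +_; -[1+_])
import Data.Integer.Properties as ℤ
open import Data.List.Base using (List; []; _∷_; allFin; filter; foldr; last; map; tabulate)
import Data.List.Extrema as Extrema
open import Data.List.Membership.Propositional using (_∈_)
open import Data.List.Membership.Propositional.Properties using (∈-filter⁺; ∈-filter⁻; ∈-allFin; ∈-map⁺)
import Data.List.Properties as List
open import Data.List.Relation.Unary.All as All using (All; []; _∷_)
import Data.List.Relation.Unary.All.Properties as All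
open import Data.List.Relation.Unary.AllPairs as AllPairs using (AllPairs; _∷_)
import Data.List.Relation.Unary.AllPairs.Properties as AllPairs
open import Data.List.Relation.Unary.Any using (here; there)
open import Data.Maybe.Base using (Maybe; just; nothing)
import Data.Maybe.Relation.Unary.All as Maybe
open import Data.Nat.Base using (zero; suc; _!)
import Data.Nat.Properties as ℕ
open import Data.Product.Base using (_×_; _,_; proj₁; proj₂; ∃; ∃₂)
open import Data.Sum.Base using (_⊎_; inj₁; inj₂)
open import Function.Base using (_∘_; case_of_)
open import Relation.Binary.Bundles using (StrictTotalOrder)
open import Relation.Binary.Core using (Rel)
open import Relation.Binary.Definitions using (tri<; tri≈; tri>)
import Relation.Binary.Properties.StrictTotalOrder as StrictTotalOrderProperties
open import Relation.Binary.PropositionalEquality.Core as ≡ using (_≡_)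
import Relation.Binary.Reasoning.Setoid as SetoidReasoning
import Relation.Binary.Reasoning.StrictPartialOrder as StrictPartialOrderReasoning
open import Relation.Nullary using (¬_; yes; no)
open import Relation.Nullary.Decidable using (does; _×-dec_)
open import Relation.Unary using (Decidable)

-- The bound π / n on ∣ φ ∣ is what keeps the angles kφ with k ≤ n from passing ±π, so that a single
-- half-plane contains all the powers of w up to wⁿ. Values of the form at the zᵐ alone satisfy no
-- recursion, since multiplying by z = v + w also produces w zᵐ; the induction therefore runs over
-- all products wᵏ zᵐ with k + m ≤ n.
--
-- Much of the length comes from `lim`, `root` and `π` being definite descriptions: nothing is known
-- of their values until a witness is produced. Convergence is therefore proved with explicit errors
-- C ½ⁿ, completeness supplying the limits. The addition formula for `exp` is first obtained
-- formally: the terms of exp x form the only solution of a 0 = 1, ∂a = x a, and by the Leibniz rule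
-- the Cauchy product of the solutions for x and y is the solution for x + y. What remains for
-- analysis is to bound those products of terms that a partial sum of the Cauchy product omits.

-- Ring equations with integer coefficients

module IntegerSolver (R : CommutativeRing 0ℓ 0ℓ) where

  open CommutativeRing R
  open RingProperties ring using (-0#≈0#; -‿distribˡ-*; -‿distribʳ-*; -‿involutive)
  open AbelianGroupProperties +-abelianGroup using (⁻¹-∙-comm)
  open SemiringMultTCOptimised semiring
    using (×-homo-+; ×1-homo-*; 1+×) renaming (_×_ to _·_)
  open SetoidReasoning setoid

  -- The optimised multiple makes `⟦ + 1 ⟧` reduce to `1#`, so the solver constants `:0` and `:1`
  -- denote `0#` and `1#` definitionally.
  ⟦_⟧ : ℤ → Carrier
  ⟦ + n ⟧      = n · 1#
  ⟦ -[1+ n ] ⟧ = - (suc n · 1#)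

  ⟦⊖⟧ : ∀ m n → ⟦ m ℤ.⊖ n ⟧ ≈ m · 1# - n · 1#
  ⟦⊖⟧ zero    zero    = sym (-‿inverseʳ 0#)
  ⟦⊖⟧ zero    (suc n) = sym (+-identityˡ _)
  ⟦⊖⟧ (suc m) zero    = sym (trans (+-congˡ -0#≈0#) (+-identityʳ _))
  ⟦⊖⟧ (suc m) (suc n) = begin
    ⟦ suc m ℤ.⊖ suc n ⟧                     ≡⟨ ≡.cong ⟦_⟧ (ℤ.[1+m]⊖[1+n]≡m⊖n m n) ⟩
    ⟦ m ℤ.⊖ n ⟧                             ≈⟨ ⟦⊖⟧ m n ⟩
    m · 1# - n · 1#                       ≈⟨ +-congˡ (+-identityˡ _) ⟨
    m · 1# + (0# - n · 1#)                ≈⟨ +-congˡ (+-congʳ (-‿inverseʳ 1#)) ⟨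
    m · 1# + (1# - 1# - n · 1#)           ≈⟨ +-congˡ (+-assoc _ _ _) ⟩
    m · 1# + (1# + (- 1# - n · 1#))       ≈⟨ +-assoc _ _ _ ⟨
    m · 1# + 1# + (- 1# - n · 1#)         ≈⟨ +-cong (+-comm _ _) (⁻¹-∙-comm _ _) ⟩
    1# + m · 1# - (1# + n · 1#)           ≈⟨ +-cong (1+× m 1#) (-‿cong (1+× n 1#)) ⟨
    suc m · 1# - suc n · 1#               ∎

  +-homo : ∀ i j → ⟦ i ℤ.+ j ⟧ ≈ ⟦ i ⟧ + ⟦ j ⟧
  +-homo (+ m)      (+ n)      = ×-homo-+ 1# m n
  +-homo (+ m)      -[1+ n ]   = ⟦⊖⟧ m (suc n)
  +-homo -[1+ m ]   (+ n)      = trans (⟦⊖⟧ n (suc m)) (+-comm _ _)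
  +-homo -[1+ m ]   -[1+ n ]   = begin
    - (suc (suc (m ℕ.+ n)) · 1#)       ≈⟨ -‿cong (trans (1+× (suc (m ℕ.+ n)) 1#)
                                           (trans (+-congˡ (×-homo-+ 1# (suc m) n)) (+-congˡ (+-comm _ _)))) ⟩
    - (1# + (n · 1# + suc m · 1#))     ≈⟨ -‿cong (+-assoc _ _ _) ⟨
    - (1# + n · 1# + suc m · 1#)       ≈⟨ -‿cong (trans (+-congʳ (sym (1+× n 1#))) (+-comm _ _)) ⟩
    - (suc m · 1# + suc n · 1#)        ≈⟨ ⁻¹-∙-comm _ _ ⟨
    - (suc m · 1#) - suc n · 1#        ∎

  -‿homo : ∀ i → ⟦ ℤ.- i ⟧ ≈ - ⟦ i ⟧
  -‿homo (+ zero)   = sym -0#≈0#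
  -‿homo (+ suc n)  = refl
  -‿homo -[1+ n ]   = sym (-‿involutive _)

  *-homo⁺ : ∀ m j → ⟦ + m ℤ.* j ⟧ ≈ m · 1# * ⟦ j ⟧
  *-homo⁺ m (+ n)    = trans (reflexive (≡.cong ⟦_⟧ (≡.sym (ℤ.pos-* m n)))) (×1-homo-* m n)
  *-homo⁺ m -[1+ n ] = begin
    ⟦ + m ℤ.* (ℤ.- + suc n) ⟧   ≡⟨ ≡.cong ⟦_⟧ (ℤ.neg-distribʳ-* (+ m) (+ suc n)) ⟨
    ⟦ ℤ.- (+ m ℤ.* + suc n) ⟧   ≈⟨ -‿homo (+ m ℤ.* + suc n) ⟩
    - ⟦ + m ℤ.* + suc n ⟧       ≈⟨ -‿cong (*-homo⁺ m (+ suc n)) ⟩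
    - (m · 1# * (suc n · 1#))   ≈⟨ -‿distribʳ-* _ _ ⟩
    m · 1# * ⟦ -[1+ n ] ⟧       ∎

  *-homo : ∀ i j → ⟦ i ℤ.* j ⟧ ≈ ⟦ i ⟧ * ⟦ j ⟧
  *-homo (+ m)    j = *-homo⁺ m j
  *-homo -[1+ m ] j = begin
    ⟦ (ℤ.- + suc m) ℤ.* j ⟧   ≡⟨ ≡.cong ⟦_⟧ (ℤ.neg-distribˡ-* (+ suc m) j) ⟨
    ⟦ ℤ.- (+ suc m ℤ.* j) ⟧   ≈⟨ -‿homo (+ suc m ℤ.* j) ⟩
    - ⟦ + suc m ℤ.* j ⟧       ≈⟨ -‿cong (*-homo⁺ (suc m) j) ⟩
    - (suc m · 1# * ⟦ j ⟧)    ≈⟨ -‿distribˡ-* _ _ ⟩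
    ⟦ -[1+ m ] ⟧ * ⟦ j ⟧      ∎

  morphism : ℤ.+-*-rawRing -Raw-AlmostCommutative⟶ fromCommutativeRing R
  morphism = record
    { ⟦_⟧ = ⟦_⟧ ; +-homo = +-homo ; *-homo = *-homo ; -‿homo = -‿homo
    ; 0-homo = refl ; 1-homo = refl }

  coefficient≟ : ∀ i j → Maybe (⟦ i ⟧ ≈ ⟦ j ⟧)
  coefficient≟ i j with i ℤ.≟ j
  ... | yes ≡.refl = just refl
  ... | no  _      = nothing

  open RingSolver ℤ.+-*-rawRing (fromCommutativeRing R) morphism coefficient≟ public
    using (solve; con; _:+_; _:*_; _:-_; :-_; _:=_)
  pattern :0 = con (+ 0)
  pattern :1 = con (+ 1)

-- Formal power series and the exponential recursion

module ExponentialSequences (A : CommutativeRing 0ℓ 0ℓ) where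

  open CommutativeRing A renaming (Carrier to C)
  open IntegerSolver A
  open RawSemiringDefinitions (Semiring.rawSemiring semiring) using (sum; _^_) renaming (_×_ to _·_)
  open SemiringSum semiring
    using (sum-cong-≋; ∑-distrib-+; *-distribˡ-sum)
  open SetoidReasoning setoid

  Sequence : Set
  Sequence = ℕ → C

  Σ : Sequence → Sequence
  Σ a n = sum {n} λ k → a (toℕ k)

  Σ-suc : ∀ a n → Σ a (suc n) ≈ Σ a n + a n
  Σ-suc a zero    = +-comm _ _
  Σ-suc a (suc n) = trans (+-congˡ (Σ-suc (a ∘ suc) n)) (sym (+-assoc _ _ _))

  Σ-cong : ∀ {a b} → (∀ k → a k ≈ b k) → ∀ n → Σ a n ≈ Σ b n
  Σ-cong p n = sum-cong-≋ {n} (λ k → p (toℕ k))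

  -- _∗_ is the Cauchy product and ∂ the formal derivative of power series.
  infixl 7 _∗_
  _∗_ : Sequence → Sequence → Sequence
  (a ∗ b) zero    = a 0 * b 0
  (a ∗ b) (suc n) = a 0 * b (suc n) + (a ∘ suc ∗ b) n

  ∂ : Sequence → Sequence
  ∂ a n = suc n · 1# * a (suc n)

  ∗-cong : ∀ {a a′ b b′} → (∀ k → a k ≈ a′ k) → (∀ k → b k ≈ b′ k) →
           ∀ n → (a ∗ b) n ≈ (a′ ∗ b′) n
  ∗-cong p q zero    = *-cong (p 0) (q 0)
  ∗-cong p q (suc n) = +-cong (*-cong (p 0) (q (suc n))) (∗-cong (p ∘ suc) q n)

  ∗-distribʳ-+ : ∀ a a′ b n → ((λ k → a k + a′ k) ∗ b) n ≈ (a ∗ b) n + (a′ ∗ b) n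
  ∗-distribʳ-+ a a′ b zero    = distribʳ _ _ _
  ∗-distribʳ-+ a a′ b (suc n) = begin
    (a 0 + a′ 0) * b (suc n) + ((λ k → a (suc k) + a′ (suc k)) ∗ b) n
      ≈⟨ +-congˡ (∗-distribʳ-+ (a ∘ suc) (a′ ∘ suc) b n) ⟩
    (a 0 + a′ 0) * b (suc n) + ((a ∘ suc ∗ b) n + (a′ ∘ suc ∗ b) n)
      ≈⟨ solve 5 (λ x y b u v → (x :+ y) :* b :+ (u :+ v) := (x :* b :+ u) :+ (y :* b :+ v)) refl
           (a 0) (a′ 0) (b (suc n)) ((a ∘ suc ∗ b) n) ((a′ ∘ suc ∗ b) n) ⟩
    (a ∗ b) (suc n) + (a′ ∗ b) (suc n) ∎

  ∗-scaleˡ : ∀ x a b n → ((λ k → x * a k) ∗ b) n ≈ x * (a ∗ b) n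
  ∗-scaleˡ x a b zero    = *-assoc _ _ _
  ∗-scaleˡ x a b (suc n) =
    trans (+-cong (*-assoc _ _ _) (∗-scaleˡ x (a ∘ suc) b n)) (sym (distribˡ _ _ _))

  ∗-scaleʳ : ∀ x a b n → (a ∗ (λ k → x * b k)) n ≈ x * (a ∗ b) n
  ∗-scaleʳ x a b zero    = solve 3 (λ x a b → a :* (x :* b) := x :* (a :* b)) refl x (a 0) (b 0)
  ∗-scaleʳ x a b (suc n) = trans (+-congˡ (∗-scaleʳ x (a ∘ suc) b n))
    (solve 4 (λ x a b c → a :* (x :* b) :+ x :* c := x :* (a :* b :+ c)) refl
      x (a 0) (b (suc n)) ((a ∘ suc ∗ b) n))

  -- Induction along the shift of the first factor. Shifting and `∂` do not commute: the shift of
  -- `∂ a` exceeds `∂ (a ∘ suc)` by `a ∘ suc ∘ suc`, and the one extra copy of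
  -- `(a ∘ suc ∗ b) (suc n)` in the coefficient n + 2 supplies exactly this term.
  leibniz : ∀ a b n → ∂ (a ∗ b) n ≈ (∂ a ∗ b) n + (a ∗ ∂ b) n
  leibniz a b zero    =
    solve 4 (λ a₀ a₁ b₀ b₁ → (:1 :+ :0) :* (a₀ :* b₁ :+ a₁ :* b₀) :=
                             (:1 :+ :0) :* a₁ :* b₀ :+ a₀ :* ((:1 :+ :0) :* b₁)) refl
      (a 0) (a 1) (b 0) (b 1)
  leibniz a b (suc n) = begin
    suc (suc n) · 1# * (a 0 * b (suc (suc n)) + (a ∘ suc ∗ b) (suc n))
      ≈⟨ solve 5 (λ m a₀ b₂ u v → (:1 :+ m) :* (a₀ :* b₂ :+ (u :+ v)) :=
                   (u :+ v) :+ a₀ :* ((:1 :+ m) :* b₂) :+ m :* (u :+ v)) refl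
           (suc n · 1#) (a 0) (b (suc (suc n))) (a 1 * b (suc n)) ((a ∘ suc ∘ suc ∗ b) n) ⟩
    a 1 * b (suc n) + (a ∘ suc ∘ suc ∗ b) n + a 0 * ∂ b (suc n) + ∂ (a ∘ suc ∗ b) n
      ≈⟨ +-congˡ (leibniz (a ∘ suc) b n) ⟩
    a 1 * b (suc n) + (a ∘ suc ∘ suc ∗ b) n + a 0 * ∂ b (suc n)
      + ((∂ (a ∘ suc) ∗ b) n + (a ∘ suc ∗ ∂ b) n)
      ≈⟨ solve 6 (λ a₁ b₁ u v w x → a₁ :* b₁ :+ u :+ v :+ (w :+ x) :=
                   (:1 :+ :0) :* a₁ :* b₁ :+ (u :+ w) :+ (v :+ x)) refl
           (a 1) (b (suc n)) ((a ∘ suc ∘ suc ∗ b) n) (a 0 * ∂ b (suc n))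
           ((∂ (a ∘ suc) ∗ b) n) ((a ∘ suc ∗ ∂ b) n) ⟩
    ∂ a 0 * b (suc n) + ((a ∘ suc ∘ suc ∗ b) n + (∂ (a ∘ suc) ∗ b) n) + (a ∗ ∂ b) (suc n)
      ≈⟨ +-congʳ (+-congˡ (∗-distribʳ-+ (a ∘ suc ∘ suc) (∂ (a ∘ suc)) b n)) ⟨
    ∂ a 0 * b (suc n) + ((λ k → a (suc (suc k)) + ∂ (a ∘ suc) k) ∗ b) n + (a ∗ ∂ b) (suc n)
      ≈⟨ +-congʳ (+-congˡ (∗-cong {b = b} (λ k →
           solve 2 (λ m x → x :+ m :* x := (:1 :+ m) :* x) refl (suc k · 1#) (a (suc (suc k))))
           (λ _ → refl) n)) ⟩
    (∂ a ∗ b) (suc n) + (a ∗ ∂ b) (suc n) ∎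

  -- The coefficients of the formal series e^(xT), characterised by y′ = x y and y(0) = 1; at T = 1
  -- the series has the terms of exp x.
  Exponential : C → Sequence → Set
  Exponential x a = a 0 ≈ 1# × (∀ n → ∂ a n ≈ x * a n)

  ∗-exponential : ∀ {x y a b} → Exponential x a → Exponential y b → Exponential (x + y) (a ∗ b)
  ∗-exponential {x} {y} {a} {b} (a₀ , ∂a) (b₀ , ∂b) =
    trans (*-cong a₀ b₀) (*-identityˡ 1#) , λ n → begin
      ∂ (a ∗ b) n                                         ≈⟨ leibniz a b n ⟩
      (∂ a ∗ b) n + (a ∗ ∂ b) n                           ≈⟨ +-cong (∗-cong {b = b} ∂a (λ _ → refl) n)
                                                                    (∗-cong {a = a} (λ _ → refl) ∂b n) ⟩
      ((λ k → x * a k) ∗ b) n + (a ∗ (λ k → y * b k)) n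
        ≈⟨ +-cong (∗-scaleˡ x a b n) (∗-scaleʳ y a b n) ⟩
      x * (a ∗ b) n + y * (a ∗ b) n                       ≈⟨ distribʳ _ _ _ ⟨
      (x + y) * (a ∗ b) n                                 ∎

  powerSeries-exponential : ∀ {c : Sequence} → c 0 ≈ 1# → (∀ n → suc n · 1# * c (suc n) ≈ c n) →
                            ∀ x → Exponential x (λ k → c k * x ^ k)
  powerSeries-exponential {c} c₀ ∂c x = trans (*-identityʳ _) c₀ , λ n → begin
    suc n · 1# * (c (suc n) * (x * x ^ n))
      ≈⟨ solve 4 (λ m c x p → m :* (c :* (x :* p)) := x :* ((m :* c) :* p)) refl
           (suc n · 1#) (c (suc n)) x (x ^ n) ⟩
    x * ((suc n · 1# * c (suc n)) * x ^ n)
      ≈⟨ *-congˡ (*-congʳ (∂c n)) ⟩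
    x * (c n * x ^ n) ∎

  -- Each term determines the next one, as n + 1 can be cancelled from (n + 1) aₙ₊₁ = x aₙ.
  exponential-unique : (∀ n → ∃ λ y → suc n · 1# * y ≈ 1#) →
                       ∀ {x a b} → Exponential x a → Exponential x b → ∀ n → a n ≈ b n
  exponential-unique invertible (a₀ , _) (b₀ , _) zero = trans a₀ (sym b₀)
  exponential-unique invertible {x} {a} {b} a-exp@(_ , ∂a) b-exp@(_ , ∂b) (suc n) = begin
    a (suc n)         ≈⟨ cancel (a (suc n)) ⟩
    y * ∂ a n         ≈⟨ *-congˡ (∂a n) ⟩
    y * (x * a n)     ≈⟨ *-congˡ (*-congˡ (exponential-unique invertible {x} {a} {b} a-exp b-exp n)) ⟩
    y * (x * b n)     ≈⟨ *-congˡ (∂b n) ⟨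
    y * ∂ b n         ≈⟨ cancel (b (suc n)) ⟨
    b (suc n)         ∎
    where
    y = proj₁ (invertible n)
    cancel : ∀ z → z ≈ y * (suc n · 1# * z)
    cancel z = begin
      z                       ≈⟨ *-identityˡ z ⟨
      1# * z                  ≈⟨ *-congʳ (proj₂ (invertible n)) ⟨
      suc n · 1# * y * z
        ≈⟨ solve 3 (λ m y z → m :* y :* z := y :* (m :* z)) refl (suc n · 1#) y z ⟩
      y * (suc n · 1# * z)    ∎

  exponential-1 : ∀ {x a} → Exponential x a → a 1 ≈ x
  exponential-1 {x} {a} (a₀ , ∂a) = begin
    a 1         ≈⟨ solve 1 (λ a → a := (:1 :+ :0) :* a) refl (a 1) ⟩
    ∂ a 0       ≈⟨ ∂a 0 ⟩
    x * a 0     ≈⟨ *-congˡ a₀ ⟩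
    x * 1#      ≈⟨ *-identityʳ x ⟩
    x           ∎

  exponential-tail : ∀ {x a} → Exponential x a →
                     ∀ n → Σ a (suc (suc n)) - (1# + x) ≈ Σ (a ∘ suc ∘ suc) n
  exponential-tail {x} {a} a-exp n = begin
    a 0 + (a 1 + Σ (a ∘ suc ∘ suc) n) - (1# + x)
      ≈⟨ +-congˡ (-‿cong (+-cong (proj₁ a-exp) (exponential-1 {x} {a} a-exp))) ⟨
    a 0 + (a 1 + Σ (a ∘ suc ∘ suc) n) - (a 0 + a 1)
      ≈⟨ solve 3 (λ a b c → a :+ (b :+ c) :- (a :+ b) := c) refl (a 0) (a 1) (Σ (a ∘ suc ∘ suc) n) ⟩
    Σ (a ∘ suc ∘ suc) n ∎

  Σ-∗-suc : ∀ a b n → Σ (a ∗ b) (suc n) ≈ a 0 * Σ b (suc n) + Σ (a ∘ suc ∗ b) n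
  Σ-∗-suc a b n = begin
    a 0 * b 0 + Σ (λ k → a 0 * b (suc k) + (a ∘ suc ∗ b) k) n
      ≈⟨ +-congˡ (∑-distrib-+ {n} (λ k → a 0 * b (suc (toℕ k))) (λ k → (a ∘ suc ∗ b) (toℕ k))) ⟩
    a 0 * b 0 + (Σ (λ k → a 0 * b (suc k)) n + Σ (a ∘ suc ∗ b) n)
      ≈⟨ +-congˡ (+-congʳ (*-distribˡ-sum {n} (a 0) (λ k → b (suc (toℕ k))))) ⟨
    a 0 * b 0 + (a 0 * Σ (b ∘ suc) n + Σ (a ∘ suc ∗ b) n)
      ≈⟨ solve 4 (λ a b s t → a :* b :+ (a :* s :+ t) := a :* (b :+ s) :+ t) refl
           (a 0) (b 0) (Σ (b ∘ suc) n) (Σ (a ∘ suc ∗ b) n) ⟩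
    a 0 * Σ b (suc n) + Σ (a ∘ suc ∗ b) n ∎

  -- The sum of the products aᵢ bⱼ with i, j < n and i + j ≥ n.
  defect : Sequence → Sequence → Sequence
  defect a b n = Σ a n * Σ b n - Σ (a ∗ b) n

  defect-suc : ∀ a b n → defect a b (suc n) ≈ defect (a ∘ suc) b n + Σ (a ∘ suc) n * b n
  defect-suc a b n = begin
    (a 0 + Σ (a ∘ suc) n) * Σ b (suc n) - Σ (a ∗ b) (suc n)
      ≈⟨ +-congˡ (-‿cong (Σ-∗-suc a b n)) ⟩
    (a 0 + Σ (a ∘ suc) n) * Σ b (suc n) - (a 0 * Σ b (suc n) + Σ (a ∘ suc ∗ b) n)
      ≈⟨ solve 4 (λ a s t c → (a :+ s) :* t :- (a :* t :+ c) := s :* t :- c) refl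
           (a 0) (Σ (a ∘ suc) n) (Σ b (suc n)) (Σ (a ∘ suc ∗ b) n) ⟩
    Σ (a ∘ suc) n * Σ b (suc n) - Σ (a ∘ suc ∗ b) n
      ≈⟨ +-congʳ (*-congˡ (Σ-suc b n)) ⟩
    Σ (a ∘ suc) n * (Σ b n + b n) - Σ (a ∘ suc ∗ b) n
      ≈⟨ solve 4 (λ s t b c → s :* (t :+ b) :- c := s :* t :- c :+ s :* b) refl
           (Σ (a ∘ suc) n) (Σ b n) (b n) (Σ (a ∘ suc ∗ b) n) ⟩
    defect (a ∘ suc) b n + Σ (a ∘ suc) n * b n ∎

-- Last elements of sorted lists

module SortedLists {A : Set} where

  last-∈ : ∀ {xs : List A} {y} → last xs ≡ just y → y ∈ xs
  last-∈ {x ∷ []}     ≡.refl = here ≡.refl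
  last-∈ {x ∷ y ∷ xs} p      = there (last-∈ p)

  last-nothing : ∀ {xs : List A} → last xs ≡ nothing → xs ≡ []
  last-nothing {[]}         _ = ≡.refl
  last-nothing {x ∷ y ∷ xs} p with () ← last-nothing {y ∷ xs} p

  last-maximum : ∀ {_<_ : Rel A 0ℓ} {xs y} → AllPairs _<_ xs → last xs ≡ just y →
                 ∀ {x} → x ∈ xs → x ≡ y ⊎ x < y
  last-maximum {xs = x ∷ []}     _            ≡.refl (here ≡.refl) = inj₁ ≡.refl
  last-maximum {xs = x ∷ y ∷ xs} (x< ∷ _)     p      (here ≡.refl) = inj₂ (All.lookup x< (last-∈ p))
  last-maximum {xs = x ∷ y ∷ xs} (_ ∷ sorted) p      (there q)     = last-maximum sorted p q

module _ (em : ExcludedMiddle 0ℓ) (R : CompleteOrderedField) where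

  -- Order, absolute value and the Archimedean property

  module OrderedField where

    open Analysis em R public hiding (zero)
    open StrictTotalOrder strictTotalOrder public
      using (compare; <-respˡ-≈; <-respʳ-≈; strictPartialOrder)
      renaming (trans to <-trans; irrefl to <-irrefl; asym to <-asym)
    open StrictTotalOrderProperties strictTotalOrder public
      using (total) renaming (trans to ≤-trans; antisym to ≤-antisym; reflexive to ≤-reflexive)
    open StrictPartialOrderReasoning strictPartialOrder public
    open IntegerSolver commutativeRing public
    open RingProperties ring public
      using (-0#≈0#; -‿distribˡ-*; -‿distribʳ-*)
    open SemiringMult semiring public using (×1-homo-*)

    <⇒≤ : ∀ {x y} → x < y → x ≤ y
    <⇒≤ = inj₁

    ≈⇒≤ : ∀ {x y} → x ≈ y → x ≤ y
    ≈⇒≤ = inj₂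

    ≤-refl : ∀ {x} → x ≤ x
    ≤-refl = ≈⇒≤ refl

    <-≤-trans : ∀ {x y z} → x < y → y ≤ z → x < z
    <-≤-trans {x} {y} {z} p q = begin-strict x <⟨ p ⟩ y ≤⟨ q ⟩ z ∎

    ≤-<-trans : ∀ {x y z} → x ≤ y → y < z → x < z
    ≤-<-trans {x} {y} {z} p q = begin-strict x ≤⟨ p ⟩ y <⟨ q ⟩ z ∎

    ≤⇒≯ : ∀ {x y} → x ≤ y → ¬ y < x
    ≤⇒≯ p q = <-irrefl refl (≤-<-trans p q)

    ≮⇒≥ : ∀ {x y} → ¬ x < y → y ≤ x
    ≮⇒≥ {x} {y} p with compare x y
    ... | tri< q _ _ = ⊥-elim (p q)
    ... | tri≈ _ q _ = ≈⇒≤ (sym q)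
    ... | tri> _ _ q = <⇒≤ q

    +-monoˡ-≤ : ∀ z {x y} → x ≤ y → x + z ≤ y + z
    +-monoˡ-≤ z (inj₁ p) = <⇒≤ (+-monoˡ-< z p)
    +-monoˡ-≤ z (inj₂ p) = ≈⇒≤ (+-congʳ p)

    +-monoʳ-≤ : ∀ z {x y} → x ≤ y → z + x ≤ z + y
    +-monoʳ-≤ z {x} {y} p = begin
      z + x ≈⟨ +-comm z x ⟩ x + z ≤⟨ +-monoˡ-≤ z p ⟩ y + z ≈⟨ +-comm y z ⟩ z + y ∎

    +-mono-≤ : ∀ {x y u v} → x ≤ y → u ≤ v → x + u ≤ y + v
    +-mono-≤ p q = ≤-trans (+-monoˡ-≤ _ p) (+-monoʳ-≤ _ q)

    +-mono-<-≤ : ∀ {x y u v} → x < y → u ≤ v → x + u < y + v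
    +-mono-<-≤ p q = <-≤-trans (+-monoˡ-< _ p) (+-monoʳ-≤ _ q)

    +-mono-≤-< : ∀ {x y u v} → x ≤ y → u < v → x + u < y + v
    +-mono-≤-< {x} {y} {u} {v} p q = begin-strict
      x + u ≈⟨ +-comm x u ⟩ u + x <⟨ +-mono-<-≤ q p ⟩ v + y ≈⟨ +-comm v y ⟩ y + v ∎

    <⇒0<- : ∀ {x y} → x < y → 0# < y - x
    <⇒0<- {x} p = <-respˡ-≈ (-‿inverseʳ x) (+-monoˡ-< (- x) p)

    0<-⇒< : ∀ {x y} → 0# < y - x → x < y
    0<-⇒< {x} {y} p = begin-strict
      x ≈⟨ solve 1 (λ x → x := :0 :+ x) refl x ⟩
      0# + x <⟨ +-monoˡ-< x p ⟩
      y - x + x ≈⟨ solve 2 (λ x y → y :- x :+ x := y) refl x y ⟩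
      y ∎

    ≤⇒0≤- : ∀ {x y} → x ≤ y → 0# ≤ y - x
    ≤⇒0≤- (inj₁ p) = <⇒≤ (<⇒0<- p)
    ≤⇒0≤- {x} {y} (inj₂ p) = ≈⇒≤ (trans (sym (-‿inverseʳ x)) (+-congʳ p))

    0≤-⇒≤ : ∀ {x y} → 0# ≤ y - x → x ≤ y
    0≤-⇒≤ (inj₁ p) = <⇒≤ (0<-⇒< p)
    0≤-⇒≤ {x} {y} (inj₂ p) = ≈⇒≤ (begin-equality
      x ≈⟨ solve 2 (λ x y → x := y :- (y :- x)) refl x y ⟩
      y - (y - x) ≈⟨ +-congˡ (-‿cong p) ⟨
      y - 0# ≈⟨ solve 1 (λ y → y :- :0 := y) refl y ⟩
      y ∎)

    x≤x+y : ∀ {x y} → 0# ≤ y → x ≤ x + y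
    x≤x+y {x} {y} p = 0≤-⇒≤ (≤-trans p (≈⇒≤ (solve 2 (λ x y → y := x :+ y :- x) refl x y)))

    x<x+y : ∀ {x y} → 0# < y → x < x + y
    x<x+y {x} {y} p = 0<-⇒< (<-≤-trans p (≈⇒≤ (solve 2 (λ x y → y := x :+ y :- x) refl x y)))

    neg-mono-≤ : ∀ {x y} → x ≤ y → - y ≤ - x
    neg-mono-≤ {x} {y} p = 0≤-⇒≤ (≤-trans (≤⇒0≤- p)
      (≈⇒≤ (solve 2 (λ x y → y :- x := :- x :- :- y) refl x y)))

    neg-mono-< : ∀ {x y} → x < y → - y < - x
    neg-mono-< {x} {y} p = 0<-⇒< (<-≤-trans (<⇒0<- p)
      (≈⇒≤ (solve 2 (λ x y → y :- x := :- x :- :- y) refl x y)))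

    <0⇒0<- : ∀ {x} → x < 0# → 0# < - x
    <0⇒0<- p = <-respˡ-≈ -0#≈0# (neg-mono-< p)

    0≤x+y : ∀ {x y} → 0# ≤ x → 0# ≤ y → 0# ≤ x + y
    0≤x+y p q = ≤-trans p (x≤x+y q)

    0<x+y : ∀ {x y} → 0# < x → 0# ≤ y → 0# < x + y
    0<x+y p q = <-≤-trans p (x≤x+y q)

    0≤x*y : ∀ {x y} → 0# ≤ x → 0# ≤ y → 0# ≤ x * y
    0≤x*y (inj₁ p) (inj₁ q) = <⇒≤ (*-positive p q)
    0≤x*y (inj₂ p) _        = ≈⇒≤ (trans (sym (zeroˡ _)) (*-congʳ p))
    0≤x*y (inj₁ p) (inj₂ q) = ≈⇒≤ (trans (sym (zeroʳ _)) (*-congˡ q))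

    *-monoˡ-≤ : ∀ {z x y} → 0# ≤ z → x ≤ y → z * x ≤ z * y
    *-monoˡ-≤ {z} {x} {y} p q = 0≤-⇒≤ (≤-trans (0≤x*y p (≤⇒0≤- q))
      (≈⇒≤ (solve 3 (λ x y z → z :* (y :- x) := z :* y :- z :* x) refl x y z)))

    *-monoˡ-< : ∀ {z x y} → 0# < z → x < y → z * x < z * y
    *-monoˡ-< {z} {x} {y} p q = 0<-⇒< (<-≤-trans (*-positive p (<⇒0<- q))
      (≈⇒≤ (solve 3 (λ x y z → z :* (y :- x) := z :* y :- z :* x) refl x y z)))

    *-monoʳ-≤ : ∀ {z x y} → 0# ≤ z → x ≤ y → x * z ≤ y * z
    *-monoʳ-≤ {z} {x} {y} p q = begin
      x * z ≈⟨ *-comm x z ⟩ z * x ≤⟨ *-monoˡ-≤ p q ⟩ z * y ≈⟨ *-comm z y ⟩ y * z ∎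

    *-mono-≤ : ∀ {x y u v} → 0# ≤ u → 0# ≤ y → x ≤ y → u ≤ v → x * u ≤ y * v
    *-mono-≤ 0≤u 0≤y p q = ≤-trans (*-monoʳ-≤ 0≤u p) (*-monoˡ-≤ 0≤y q)

    *-cancelˡ-< : ∀ {z x y} → 0# ≤ z → z * x < z * y → x < y
    *-cancelˡ-< {z} {x} {y} p q with compare x y
    ... | tri< r _ _ = r
    ... | tri≈ _ r _ = ⊥-elim (<-irrefl (*-congˡ r) q)
    ... | tri> _ _ r = ⊥-elim (≤⇒≯ (*-monoˡ-≤ p (<⇒≤ r)) q)

    *-cancelˡ-≤ : ∀ {z x y} → 0# < z → z * x ≤ z * y → x ≤ y
    *-cancelˡ-≤ {z} {x} {y} p q = ≮⇒≥ λ r → ≤⇒≯ q (*-monoˡ-< p r)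

    0<1 : 0# < 1#
    0<1 with compare 0# 1#
    ... | tri< p _ _ = p
    ... | tri≈ _ p _ = ⊥-elim (0≉1 p)
    ... | tri> _ _ p = ⊥-elim (<-asym p (<-≤-trans (*-positive (<0⇒0<- p) (<0⇒0<- p))
      (≈⇒≤ (solve 0 (:- :1 :* :- :1 := :1) refl))))

    0≤1 : 0# ≤ 1#
    0≤1 = <⇒≤ 0<1

    0≤x² : ∀ x → 0# ≤ x * x
    0≤x² x with compare 0# x
    ... | tri< p _ _ = <⇒≤ (*-positive p p)
    ... | tri≈ _ p _ = 0≤x*y (≈⇒≤ p) (≈⇒≤ p)
    ... | tri> _ _ p = ≤-trans (<⇒≤ (*-positive (<0⇒0<- p) (<0⇒0<- p)))
      (≈⇒≤ (solve 1 (λ x → :- x :* :- x := x :* x) refl x))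

    >⇒≉ : ∀ {x} → 0# < x → x ≉ 0#
    >⇒≉ p q = <-irrefl (sym q) p

    0≤natural : ∀ n → 0# ≤ natural n
    0≤natural zero    = ≤-refl
    0≤natural (suc n) = 0≤x+y 0≤1 (0≤natural n)

    0<natural : ∀ n → 0# < natural (suc n)
    0<natural n = 0<x+y 0<1 (0≤natural n)

    natural-mono-≤ : ∀ {m n} → m ℕ.≤ n → natural m ≤ natural n
    natural-mono-≤ {n = n} ℕ.z≤n = 0≤natural n
    natural-mono-≤ (ℕ.s≤s p) = +-monoʳ-≤ 1# (natural-mono-≤ p)

    the-satisfies : ∀ {P} → ∃ P → P (the P)
    the-satisfies {P} e with em {∃ P}
    ... | yes (_ , p) = p
    ... | no  ¬e      = ⊥-elim (¬e e)

    the-default : ∀ {P} → ¬ ∃ P → the P ≈ 0#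
    the-default {P} ¬e with em {∃ P}
    ... | yes e = ⊥-elim (¬e e)
    ... | no  _ = refl

    ⁻¹-inverseʳ : ∀ {x} → x ≉ 0# → x * x ⁻¹ ≈ 1#
    ⁻¹-inverseʳ {x} x≉0 = the-satisfies (invertible x x≉0)

    0<⁻¹ : ∀ {x} → 0# < x → 0# < x ⁻¹
    0<⁻¹ {x} p = *-cancelˡ-< (<⇒≤ p) (begin-strict
      x * 0# ≈⟨ zeroʳ x ⟩ 0# <⟨ 0<1 ⟩ 1# ≈⟨ ⁻¹-inverseʳ (>⇒≉ p) ⟨ x * x ⁻¹ ∎)

    /-cancel : ∀ {x y} → 0# < y → y * (x / y) ≈ x
    /-cancel {x} {y} p = begin-equality
      y * (x * y ⁻¹) ≈⟨ solve 3 (λ x y z → y :* (x :* z) := (y :* z) :* x) refl x y (y ⁻¹) ⟩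
      y * y ⁻¹ * x   ≈⟨ *-congʳ (⁻¹-inverseʳ (>⇒≉ p)) ⟩
      1# * x         ≈⟨ *-identityˡ x ⟩
      x              ∎

    -- If the natural numbers were bounded, their supremum less 1 would be an upper bound too,
    -- because n + 1 is again a natural number.
    archimedean : ∀ x → ∃ λ n → x < natural n
    archimedean x with em {∃ λ n → x < natural n}
    ... | yes e = e
    ... | no ¬e = ⊥-elim (≤⇒≯ s≤s-1 s-1<s)
      where
      P : ℝ → Set
      P y = ∃ λ n → y ≈ natural n
      bound : UpperBound P x
      bound (n , y≈n) = ≤-trans (≈⇒≤ y≈n) (≮⇒≥ λ p → ¬e (n , p))
      supremum = complete P (0# , 0 , refl) (x , bound)
      s = proj₁ supremum
      s≤s-1 : s ≤ s - 1#
      s≤s-1 = proj₂ (proj₂ supremum) λ { {y} (n , y≈n) → 0≤-⇒≤ (≤-trans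
        (≤⇒0≤- (proj₁ (proj₂ supremum) (suc n , refl)))
        (≈⇒≤ (begin-equality
          s - (1# + natural n) ≈⟨ +-congˡ (-‿cong (+-congˡ (sym y≈n))) ⟩
          s - (1# + y) ≈⟨ solve 2 (λ s y → s :- (:1 :+ y) := s :- :1 :- y) refl s y ⟩
          s - 1# - y ∎))) }
      s-1<s : s - 1# < s
      s-1<s = 0<-⇒< (<-≤-trans 0<1 (≈⇒≤ (solve 1 (λ s → :1 := s :- (s :- :1)) refl s)))

    module ⊔ = MaxOp (NaturalMax.maxOperator totalOrder)

    ∣x∣-least : ∀ {x y} → x ≤ y → - x ≤ y → ∣ x ∣ ≤ y
    ∣x∣-least p q = ⊔.⊔-lub p q

    x≤∣x∣ : ∀ x → x ≤ ∣ x ∣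
    x≤∣x∣ x = ⊔.x≤x⊔y x (- x)

    -x≤∣x∣ : ∀ x → - x ≤ ∣ x ∣
    -x≤∣x∣ x = ⊔.x≤y⊔x x (- x)

    ∣∣-cong : ∀ {x y} → x ≈ y → ∣ x ∣ ≈ ∣ y ∣
    ∣∣-cong p = ⊔.⊔-cong p (-‿cong p)

    0≤∣x∣ : ∀ x → 0# ≤ ∣ x ∣
    0≤∣x∣ x with total 0# x
    ... | inj₁ p = ≤-trans p (x≤∣x∣ x)
    ... | inj₂ p = ≤-trans (≤-trans (≈⇒≤ (sym -0#≈0#)) (neg-mono-≤ p)) (-x≤∣x∣ x)

    ∣x∣≈x : ∀ {x} → 0# ≤ x → ∣ x ∣ ≈ x
    ∣x∣≈x {x} p = ≤-antisym
      (∣x∣-least ≤-refl (≤-trans (≤-trans (neg-mono-≤ p) (≈⇒≤ -0#≈0#)) p)) (x≤∣x∣ x)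

    ∣x+y∣≤∣x∣+∣y∣ : ∀ x y → ∣ x + y ∣ ≤ ∣ x ∣ + ∣ y ∣
    ∣x+y∣≤∣x∣+∣y∣ x y = ∣x∣-least (+-mono-≤ (x≤∣x∣ x) (x≤∣x∣ y)) (begin
      - (x + y)       ≈⟨ solve 2 (λ x y → :- (x :+ y) := :- x :- y) refl x y ⟩
      - x - y         ≤⟨ +-mono-≤ (-x≤∣x∣ x) (-x≤∣x∣ y) ⟩
      ∣ x ∣ + ∣ y ∣   ∎)

    ∣-x∣≤∣x∣ : ∀ x → ∣ - x ∣ ≤ ∣ x ∣
    ∣-x∣≤∣x∣ x = ∣x∣-least (-x≤∣x∣ x)
      (≤-trans (≈⇒≤ (solve 1 (λ x → :- :- x := x) refl x)) (x≤∣x∣ x))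

    ∣x*y∣≤∣x∣*∣y∣ : ∀ x y → ∣ x * y ∣ ≤ ∣ x ∣ * ∣ y ∣
    ∣x*y∣≤∣x∣*∣y∣ x y = ∣x∣-least (product x) (≤-trans (≈⇒≤ (-‿distribˡ-* x y))
      (≤-trans (product (- x)) (*-monoʳ-≤ (0≤∣x∣ y) (∣-x∣≤∣x∣ x))))
      where
      product : ∀ x → x * y ≤ ∣ x ∣ * ∣ y ∣
      product x with total 0# x
      ... | inj₁ p = ≤-trans (*-monoˡ-≤ p (x≤∣x∣ y)) (*-monoʳ-≤ (0≤∣x∣ y) (x≤∣x∣ x))
      ... | inj₂ p = begin
        x * y         ≈⟨ solve 2 (λ x y → x :* y := :- x :* :- y) refl x y ⟩
        - x * - y     ≤⟨ *-monoˡ-≤ (≤-trans (≈⇒≤ (sym -0#≈0#)) (neg-mono-≤ p)) (-x≤∣x∣ y) ⟩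
        - x * ∣ y ∣   ≤⟨ *-monoʳ-≤ (0≤∣x∣ y) (-x≤∣x∣ x) ⟩
        ∣ x ∣ * ∣ y ∣ ∎

  -- Real limits with geometric error bounds

  module GeometricConvergence where

    open OrderedField

    ½ : ℝ
    ½ = (1# + 1#) ⁻¹

    0<2 : 0# < 1# + 1#
    0<2 = 0<x+y 0<1 0≤1

    0<½ : 0# < ½
    0<½ = 0<⁻¹ 0<2

    ½+½≈1 : ½ + ½ ≈ 1#
    ½+½≈1 = trans (solve 1 (λ h → h :+ h := (:1 :+ :1) :* h) refl ½) (⁻¹-inverseʳ (>⇒≉ 0<2))

    ½*x+½*x≈x : ∀ x → ½ * x + ½ * x ≈ x
    ½*x+½*x≈x x = trans (sym (distribʳ x ½ ½)) (trans (*-congʳ ½+½≈1) (*-identityˡ x))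

    ½*x<x : ∀ {x} → 0# < x → ½ * x < x
    ½*x<x {x} p = <-≤-trans (x<x+y (*-positive 0<½ p)) (≈⇒≤ (½*x+½*x≈x x))

    0<½^ : ∀ n → 0# < ½ ^ n
    0<½^ zero    = 0<1
    0<½^ (suc n) = *-positive 0<½ (0<½^ n)

    0≤½^ : ∀ n → 0# ≤ ½ ^ n
    0≤½^ n = <⇒≤ (0<½^ n)

    ½^suc≤½^ : ∀ n → ½ ^ suc n ≤ ½ ^ n
    ½^suc≤½^ n = <⇒≤ (½*x<x (0<½^ n))

    ½^≤1 : ∀ n → ½ ^ n ≤ 1#
    ½^≤1 zero    = ≤-refl
    ½^≤1 (suc n) = ≤-trans (½^suc≤½^ n) (½^≤1 n)

    -- The inequality n ≤ 2ⁿ, through which the Archimedean property yields ½ⁿ → 0.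
    natural*½^≤1 : ∀ n → natural n * ½ ^ n ≤ 1#
    natural*½^≤1 zero    = ≤-trans (≈⇒≤ (zeroˡ _)) 0≤1
    natural*½^≤1 (suc n) = begin
      (1# + natural n) * (½ * ½ ^ n)
        ≈⟨ solve 3 (λ n h p → (:1 :+ n) :* (h :* p) := h :* p :+ h :* (n :* p)) refl (natural n) ½ (½ ^ n) ⟩
      ½ * ½ ^ n + ½ * (natural n * ½ ^ n)
        ≤⟨ +-mono-≤ (*-monoˡ-≤ (<⇒≤ 0<½) (½^≤1 n)) (*-monoˡ-≤ (<⇒≤ 0<½) (natural*½^≤1 n)) ⟩
      ½ * 1# + ½ * 1#
        ≈⟨ ½*x+½*x≈x 1# ⟩
      1# ∎

    -- With m ≥ N > C / ε, the product C ½ᵐ = ε (C / ε) ½ᵐ stays below ε m ½ᵐ ≤ ε.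
    geometric-null : ∀ C {ε} → 0# < ε → ∃ λ N → ∀ m → N ℕ.≤ m → C * ½ ^ m < ε
    geometric-null C {ε} 0<ε = N , small
      where
      N = proj₁ (archimedean (C / ε))
      small : ∀ m → N ℕ.≤ m → C * ½ ^ m < ε
      small m N≤m = begin-strict
        C * ½ ^ m                 ≈⟨ *-congʳ (/-cancel 0<ε) ⟨
        ε * (C / ε) * ½ ^ m       ≈⟨ *-comm _ _ ⟩
        ½ ^ m * (ε * (C / ε))     <⟨ *-monoˡ-< (0<½^ m) (*-monoˡ-< 0<ε
                                       (<-≤-trans (proj₂ (archimedean (C / ε))) (natural-mono-≤ N≤m))) ⟩
        ½ ^ m * (ε * natural m)
          ≈⟨ solve 3 (λ p e n → p :* (e :* n) := e :* (n :* p)) refl (½ ^ m) ε (natural m) ⟩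
        ε * (natural m * ½ ^ m)   ≤⟨ *-monoˡ-≤ (<⇒≤ 0<ε) (natural*½^≤1 m) ⟩
        ε * 1#                    ≈⟨ *-identityʳ ε ⟩
        ε                         ∎

    ≤geometric⇒≤0 : ∀ {x} C → (∀ N → x ≤ C * ½ ^ N) → x ≤ 0#
    ≤geometric⇒≤0 {x} C p = ≮⇒≥ λ 0<x → let N , q = geometric-null C 0<x in
      ≤⇒≯ (p N) (q N ℕ.≤-refl)

    ⟶-not-separated : ∀ {x l m} → x ⟶ l → x ⟶ m → ¬ l < m
    ⟶-not-separated {x} {l} {m} p q r = <-irrefl refl (begin-strict
      m - l
        ≈⟨ solve 3 (λ l m x → m :- l := (x :- l) :+ :- (x :- m)) refl l m (x k) ⟩
      (x k - l) - (x k - m)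
        ≤⟨ +-mono-≤ (x≤∣x∣ _) (-x≤∣x∣ _) ⟩
      ∣ x k - l ∣ + ∣ x k - m ∣
        <⟨ +-mono-<-≤ (proj₂ P k (ℕ.m≤m⊔n _ _)) (<⇒≤ (proj₂ Q k (ℕ.m≤n⊔m _ _))) ⟩
      ½ * (m - l) + ½ * (m - l)
        ≈⟨ ½*x+½*x≈x _ ⟩
      m - l ∎)
      where
      0<ε = *-positive 0<½ (<⇒0<- r)
      P = p (½ * (m - l)) 0<ε
      Q = q (½ * (m - l)) 0<ε
      k = proj₁ P ℕ.⊔ proj₁ Q

    ⟶-unique : ∀ {x l m} → x ⟶ l → x ⟶ m → l ≈ m
    ⟶-unique p q = ≤-antisym (≮⇒≥ (⟶-not-separated q p)) (≮⇒≥ (⟶-not-separated p q))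

    geometric-lim : ∀ {x l} C → (∀ N → ∣ x N - l ∣ ≤ C * ½ ^ N) → lim x ≈ l
    geometric-lim {x} {l} C p = ⟶-unique (the-satisfies (l , x⟶l)) x⟶l
      where
      x⟶l : x ⟶ l
      x⟶l ε 0<ε = let N , q = geometric-null C 0<ε in N , λ m N≤m → ≤-<-trans (p m) (q m N≤m)

    monotone : ∀ {f : ℕ → ℝ} → (∀ n → f n ≤ f (suc n)) → ∀ {m n} → m ℕ.≤ n → f m ≤ f n
    monotone {f} step m≤n = go (ℕ.≤⇒≤′ m≤n)
      where
      go : ∀ {m n} → m ℕ.≤′ n → f m ≤ f n
      go (ℕ.≤′-reflexive ≡.refl) = ≤-refl
      go (ℕ.≤′-step p)           = ≤-trans (go p) (step _)

    -- With increments at most C ½ⁿ, the interval [ s n ∓ 2 C ½ⁿ ] shrinks with n,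
    -- and the limit is the supremum of the left end points.
    geometric-limit : ∀ {s : ℕ → ℝ} C → (∀ n → ∣ s (suc n) - s n ∣ ≤ C * ½ ^ n) →
                      ∃ λ l → ∀ n → ∣ s n - l ∣ ≤ (C + C) * ½ ^ n
    geometric-limit {s} C p = l , close
      where
      -- The right end points are negated so that `monotone` serves for both ends.
      δ lower -upper : ℕ → ℝ
      δ n      = (C + C) * ½ ^ n
      lower n  = s n - δ n
      -upper n = - (s n + δ n)

      δ-suc : ∀ n → δ n ≈ δ (suc n) + C * ½ ^ n
      δ-suc n = begin-equality
        (C + C) * ½ ^ n
          ≈⟨ solve 2 (λ c p → (c :+ c) :* p := c :* p :+ c :* p) refl C (½ ^ n) ⟩
        C * ½ ^ n + C * ½ ^ n
          ≈⟨ +-congʳ (*-congˡ (½*x+½*x≈x _)) ⟨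
        C * (½ * ½ ^ n + ½ * ½ ^ n) + C * ½ ^ n
          ≈⟨ solve 3 (λ c h p → c :* (h :* p :+ h :* p) :+ c :* p := (c :+ c) :* (h :* p) :+ c :* p)
               refl C ½ (½ ^ n) ⟩
        δ (suc n) + C * ½ ^ n ∎

      lower-step : ∀ n → lower n ≤ lower (suc n)
      lower-step n = 0≤-⇒≤ (begin
        0#
          ≤⟨ ≤⇒0≤- (≤-trans (-x≤∣x∣ _) (p n)) ⟩
        C * ½ ^ n - - (s (suc n) - s n)
          ≈⟨ solve 4 (λ d s s′ c → c :- :- (s′ :- s) := (s′ :- d) :- (s :- (d :+ c)))
               refl (δ (suc n)) (s n) (s (suc n)) (C * ½ ^ n) ⟩
        lower (suc n) - (s n - (δ (suc n) + C * ½ ^ n))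
          ≈⟨ +-congˡ (-‿cong (+-congˡ (-‿cong (δ-suc n)))) ⟨
        lower (suc n) - lower n ∎)

      -upper-step : ∀ n → -upper n ≤ -upper (suc n)
      -upper-step n = 0≤-⇒≤ (begin
        0#
          ≤⟨ ≤⇒0≤- (≤-trans (x≤∣x∣ _) (p n)) ⟩
        C * ½ ^ n - (s (suc n) - s n)
          ≈⟨ solve 4 (λ d s s′ c → c :- (s′ :- s) := :- (s′ :+ d) :- :- (s :+ (d :+ c)))
               refl (δ (suc n)) (s n) (s (suc n)) (C * ½ ^ n) ⟩
        -upper (suc n) - - (s n + (δ (suc n) + C * ½ ^ n))
          ≈⟨ +-congˡ (-‿cong (-‿cong (+-congˡ (δ-suc n)))) ⟨
        -upper (suc n) - -upper n ∎)

      0≤C : 0# ≤ C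
      0≤C = ≤-trans (0≤∣x∣ _) (≤-trans (p 0) (≈⇒≤ (*-identityʳ C)))

      0≤δ : ∀ n → 0# ≤ δ n
      0≤δ n = 0≤x*y (0≤x+y 0≤C 0≤C) (0≤½^ n)

      lower≤upper : ∀ m n → lower m ≤ - -upper n
      lower≤upper m n = begin
        lower m          ≤⟨ monotone {lower} lower-step (ℕ.m≤m⊔n m n) ⟩
        s k - δ k        ≤⟨ 0≤-⇒≤ (≤-trans (0≤x+y (0≤δ k) (0≤δ k)) (≈⇒≤
                              (solve 2 (λ s d → d :+ d := :- :- (s :+ d) :- (s :- d)) refl (s k) (δ k)))) ⟩
        - -upper k       ≤⟨ neg-mono-≤ (monotone { -upper } -upper-step (ℕ.m≤n⊔m m n)) ⟩
        - -upper n       ∎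
        where k = m ℕ.⊔ n

      P : ℝ → Set
      P x = ∃ λ n → x ≈ lower n

      supremum = complete P (lower 0 , 0 , refl)
        (- -upper 0 , λ { (n , x≈) → ≤-trans (≈⇒≤ x≈) (lower≤upper n 0) })
      l = proj₁ supremum

      close : ∀ n → ∣ s n - l ∣ ≤ δ n
      close n = ∣x∣-least
        (0≤-⇒≤ (≤-trans (≤⇒0≤- (proj₁ (proj₂ supremum) (n , refl)))
          (≈⇒≤ (solve 3 (λ s d l → l :- (s :- d) := d :- (s :- l)) refl (s n) (δ n) l))))
        (0≤-⇒≤ (≤-trans (≤⇒0≤- (proj₂ (proj₂ supremum)
            λ { (m , x≈) → ≤-trans (≈⇒≤ x≈) (lower≤upper m n) }))
          (≈⇒≤ (solve 3 (λ s d l → :- :- (s :+ d) :- l := d :- :- (s :- l)) refl (s n) (δ n) l))))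

  -- The ring of complex numbers and a norm on it

  module ComplexNumbers where

    open OrderedField

    ℂ-commutativeRing : CommutativeRing 0ℓ 0ℓ
    ℂ-commutativeRing = record
      { Carrier = ℂ ; _≈_ = _≈ᶜ_ ; _+_ = _+ᶜ_ ; _*_ = _*ᶜ_ ; -_ = λ z → (- re z) +i (- im z)
      ; 0# = 0ᶜ ; 1# = 1# +i 0#
      ; isCommutativeRing = record
        { isRing = record
          { +-isAbelianGroup = record
            { isGroup = record
              { isMonoid = record
                { isSemigroup = record
                  { isMagma = record
                    { isEquivalence = record
                      { refl  = refl , refl
                      ; sym   = λ (p , q) → sym p , sym q
                      ; trans = λ (p , q) (r , s) → trans p r , trans q s
                      }
                    ; ∙-cong = λ (p , q) (r , s) → +-cong p r , +-cong q s
                    }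
                  ; assoc = λ _ _ _ → +-assoc _ _ _ , +-assoc _ _ _
                  }
                ; identity = (λ _ → +-identityˡ _ , +-identityˡ _) , (λ _ → +-identityʳ _ , +-identityʳ _)
                }
              ; inverse = (λ _ → -‿inverseˡ _ , -‿inverseˡ _) , (λ _ → -‿inverseʳ _ , -‿inverseʳ _)
              ; ⁻¹-cong = λ (p , q) → -‿cong p , -‿cong q
              }
            ; comm = λ _ _ → +-comm _ _ , +-comm _ _
            }
          ; *-cong = λ (p , q) (r , s) →
              +-cong (*-cong p r) (-‿cong (*-cong q s)) , +-cong (*-cong p s) (*-cong q r)
          ; *-assoc = λ (a +i b) (c +i d) (e +i f) →
              solve 6 (λ a b c d e f → (a :* c :- b :* d) :* e :- (a :* d :+ b :* c) :* f :=
                a :* (c :* e :- d :* f) :- b :* (c :* f :+ d :* e)) refl a b c d e f ,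
              solve 6 (λ a b c d e f → (a :* c :- b :* d) :* f :+ (a :* d :+ b :* c) :* e :=
                a :* (c :* f :+ d :* e) :+ b :* (c :* e :- d :* f)) refl a b c d e f
          ; *-identity =
              (λ (a +i b) → solve 2 (λ a b → :1 :* a :- :0 :* b := a) refl a b ,
                            solve 2 (λ a b → :1 :* b :+ :0 :* a := b) refl a b) ,
              (λ (a +i b) → solve 2 (λ a b → a :* :1 :- b :* :0 := a) refl a b ,
                            solve 2 (λ a b → a :* :0 :+ b :* :1 := b) refl a b)
          ; distrib =
              (λ (a +i b) (c +i d) (e +i f) →
                solve 6 (λ a b c d e f → a :* (c :+ e) :- b :* (d :+ f) :=
                  (a :* c :- b :* d) :+ (a :* e :- b :* f)) refl a b c d e f ,
                solve 6 (λ a b c d e f → a :* (d :+ f) :+ b :* (c :+ e) :=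
                  (a :* d :+ b :* c) :+ (a :* f :+ b :* e)) refl a b c d e f) ,
              (λ (a +i b) (c +i d) (e +i f) →
                solve 6 (λ a b c d e f → (c :+ e) :* a :- (d :+ f) :* b :=
                  (c :* a :- d :* b) :+ (e :* a :- f :* b)) refl a b c d e f ,
                solve 6 (λ a b c d e f → (c :+ e) :* b :+ (d :+ f) :* a :=
                  (c :* b :+ d :* a) :+ (e :* b :+ f :* a)) refl a b c d e f)
          }
        ; *-comm = λ (a +i b) (c +i d) →
            solve 4 (λ a b c d → a :* c :- b :* d := c :* a :- d :* b) refl a b c d ,
            solve 4 (λ a b c d → a :* d :+ b :* c := c :* b :+ d :* a) refl a b c d
        }
      }

    module ℂᵣ = CommutativeRing ℂ-commutativeRing
    open ℂᵣ public using () renaming (1# to 1ᶜ; _-_ to _-ᶜ_; -_ to -ᶜ_)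
    open IntegerSolver ℂ-commutativeRing public using ()
      renaming (solve to solveᶜ; _:+_ to _⊕_; _:*_ to _⊗_; _:-_ to _⊖_; :-_ to ⊖_; _:=_ to _⊜_)
    open ExponentialSequences ℂ-commutativeRing public
    open RawSemiringDefinitions (Semiring.rawSemiring ℂᵣ.semiring) public
      using () renaming (_×_ to _·ᶜ_)

    ι-* : ∀ x y → ι (x * y) ≈ᶜ ι x *ᶜ ι y
    ι-* x y = solve 2 (λ x y → x :* y := x :* y :- :0 :* :0) refl x y ,
              solve 2 (λ x y → :0 := x :* :0 :+ :0 :* y) refl x y

    ι-cong : ∀ {x y} → x ≈ y → ι x ≈ᶜ ι y
    ι-cong p = p , refl

    ι-natural : ∀ n → n ·ᶜ 1ᶜ ≈ᶜ ι (natural n)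
    ι-natural zero    = ℂᵣ.refl
    ι-natural (suc n) = ℂᵣ.trans (ℂᵣ.+-congˡ {x = 1ᶜ} (ι-natural n)) (refl , +-identityˡ 0#)

    ι-natural-* : ∀ n x → n ·ᶜ 1ᶜ *ᶜ ι x ≈ᶜ ι (natural n * x)
    ι-natural-* n x = ℂᵣ.trans (ℂᵣ.*-congʳ {x = ι x} (ι-natural n)) (ℂᵣ.sym (ι-* (natural n) x))

    -- The sum norm: submultiplicative like the modulus, but free of square roots.
    ‖_‖ : ℂ → ℝ
    ‖ z ‖ = ∣ re z ∣ + ∣ im z ∣

    ‖‖-cong : ∀ {z w} → z ≈ᶜ w → ‖ z ‖ ≈ ‖ w ‖
    ‖‖-cong (p , q) = +-cong (∣∣-cong p) (∣∣-cong q)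

    0≤‖z‖ : ∀ z → 0# ≤ ‖ z ‖
    0≤‖z‖ z = 0≤x+y (0≤∣x∣ _) (0≤∣x∣ _)

    ‖ι‖ : ∀ {x} → 0# ≤ x → ‖ ι x ‖ ≈ x
    ‖ι‖ p = trans (+-cong (∣x∣≈x p) (∣x∣≈x ≤-refl)) (+-identityʳ _)

    ‖0‖≈0 : ‖ 0ᶜ ‖ ≈ 0#
    ‖0‖≈0 = ‖ι‖ ≤-refl

    ∣re∣≤‖‖ : ∀ z → ∣ re z ∣ ≤ ‖ z ‖
    ∣re∣≤‖‖ z = x≤x+y (0≤∣x∣ _)

    ∣im∣≤‖‖ : ∀ z → ∣ im z ∣ ≤ ‖ z ‖
    ∣im∣≤‖‖ z = ≤-trans (x≤x+y (0≤∣x∣ _)) (≈⇒≤ (+-comm _ _))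

    ‖z‖≤0⇒z≈0 : ∀ {z} → ‖ z ‖ ≤ 0# → z ≈ᶜ 0ᶜ
    ‖z‖≤0⇒z≈0 {z} p = zero-abs (≤-trans (∣re∣≤‖‖ z) p) , zero-abs (≤-trans (∣im∣≤‖‖ z) p)
      where
      zero-abs : ∀ {x} → ∣ x ∣ ≤ 0# → x ≈ 0#
      zero-abs {x} p = ≤-antisym (≤-trans (x≤∣x∣ x) p) (begin
        0#       ≈⟨ -0#≈0# ⟨
        - 0#     ≤⟨ neg-mono-≤ (≤-trans (-x≤∣x∣ x) p) ⟩
        - - x    ≈⟨ solve 1 (λ x → :- :- x := x) refl x ⟩
        x        ∎)

    ‖z+w‖≤‖z‖+‖w‖ : ∀ z w → ‖ z +ᶜ w ‖ ≤ ‖ z ‖ + ‖ w ‖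
    ‖z+w‖≤‖z‖+‖w‖ z w = ≤-trans (+-mono-≤ (∣x+y∣≤∣x∣+∣y∣ _ _) (∣x+y∣≤∣x∣+∣y∣ _ _))
      (≈⇒≤ (solve 4 (λ a b c d → a :+ b :+ (c :+ d) := a :+ c :+ (b :+ d)) refl _ _ _ _))

    ‖-z‖≤‖z‖ : ∀ z → ‖ -ᶜ z ‖ ≤ ‖ z ‖
    ‖-z‖≤‖z‖ z = +-mono-≤ (∣-x∣≤∣x∣ _) (∣-x∣≤∣x∣ _)

    ‖z-w‖≤‖w-z‖ : ∀ z w → ‖ z -ᶜ w ‖ ≤ ‖ w -ᶜ z ‖
    ‖z-w‖≤‖w-z‖ z w = ≤-trans (≈⇒≤ (‖‖-cong (solveᶜ 2 (λ z w → z ⊖ w ⊜ ⊖ (w ⊖ z)) ℂᵣ.refl z w)))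
      (‖-z‖≤‖z‖ _)

    ‖z-v‖≤‖z-w‖+‖w-v‖ : ∀ z w v → ‖ z -ᶜ v ‖ ≤ ‖ z -ᶜ w ‖ + ‖ w -ᶜ v ‖
    ‖z-v‖≤‖z-w‖+‖w-v‖ z w v = ≤-trans
      (≈⇒≤ (‖‖-cong (solveᶜ 3 (λ z w v → z ⊖ v ⊜ (z ⊖ w) ⊕ (w ⊖ v)) ℂᵣ.refl z w v)))
      (‖z+w‖≤‖z‖+‖w‖ _ _)

    ‖z*w‖≤‖z‖*‖w‖ : ∀ z w → ‖ z *ᶜ w ‖ ≤ ‖ z ‖ * ‖ w ‖
    ‖z*w‖≤‖z‖*‖w‖ (a +i b) (c +i d) = begin
      ∣ a * c - b * d ∣ + ∣ a * d + b * c ∣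
        ≤⟨ +-mono-≤ (∣x+y∣≤∣x∣+∣y∣ _ _) (∣x+y∣≤∣x∣+∣y∣ _ _) ⟩
      (∣ a * c ∣ + ∣ - (b * d) ∣) + (∣ a * d ∣ + ∣ b * c ∣)
        ≤⟨ +-mono-≤ (+-mono-≤ (∣x*y∣≤∣x∣*∣y∣ a c) (≤-trans (∣-x∣≤∣x∣ _) (∣x*y∣≤∣x∣*∣y∣ b d)))
                    (+-mono-≤ (∣x*y∣≤∣x∣*∣y∣ a d) (∣x*y∣≤∣x∣*∣y∣ b c)) ⟩
      (∣ a ∣ * ∣ c ∣ + ∣ b ∣ * ∣ d ∣) + (∣ a ∣ * ∣ d ∣ + ∣ b ∣ * ∣ c ∣)
        ≈⟨ solve 4 (λ a b c d → (a :* c :+ b :* d) :+ (a :* d :+ b :* c) := (a :+ b) :* (c :+ d)) refl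
             (∣ a ∣) (∣ b ∣) (∣ c ∣) (∣ d ∣) ⟩
      (∣ a ∣ + ∣ b ∣) * (∣ c ∣ + ∣ d ∣) ∎

    -- The converse of submultiplicativity for nonnegative real factors. It brings n + 1 inside the
    -- norm, where the exponential recursion applies.
    *‖‖≤‖ι*‖ : ∀ {r} z → 0# ≤ r → r * ‖ z ‖ ≤ ‖ ι r *ᶜ z ‖
    *‖‖≤‖ι*‖ {r} (a +i b) 0≤r = begin
      r * (∣ a ∣ + ∣ b ∣)       ≈⟨ distribˡ r _ _ ⟩
      r * ∣ a ∣ + r * ∣ b ∣     ≤⟨ +-mono-≤ (component a) (component b) ⟩
      ∣ r * a ∣ + ∣ r * b ∣     ≈⟨ ‖‖-cong (solve 3 (λ r a b → r :* a := r :* a :- :0 :* b) refl r a b ,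
                                   solve 3 (λ r a b → r :* b := r :* b :+ :0 :* a) refl r a b) ⟩
      ‖ ι r *ᶜ (a +i b) ‖       ∎
      where
      component : ∀ x → r * ∣ x ∣ ≤ ∣ r * x ∣
      component x with ⊔.⊔-sel x (- x)
      ... | inj₁ p = ≤-trans (≈⇒≤ (*-congˡ p)) (x≤∣x∣ _)
      ... | inj₂ p = ≤-trans (≈⇒≤ (trans (*-congˡ p) (sym (-‿distribʳ-* r x)))) (-x≤∣x∣ _)

  -- Convergence, addition formula and first-order remainder of exp

  module ComplexExponential where

    open OrderedField
    open GeometricConvergence
    open ComplexNumbers

    infix 4 _⇝_ _≼_

    -- With a fixed rate in place of ε, the rules for limits reduce to arithmetic with the constants
    -- C.
    _⇝_ : (ℕ → ℂ) → ℂ → Set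
    z ⇝ l = ∃ λ C → ∀ n → ‖ z n -ᶜ l ‖ ≤ C * ½ ^ n

    ⇝-transfer : ∀ {z w l} K → z ⇝ l → (∀ n → ‖ w n -ᶜ z n ‖ ≤ K * ½ ^ n) → w ⇝ l
    ⇝-transfer {z} {w} {l} K (C , p) q = K + C , λ n → begin
      ‖ w n -ᶜ l ‖                      ≤⟨ ‖z-v‖≤‖z-w‖+‖w-v‖ (w n) (z n) l ⟩
      ‖ w n -ᶜ z n ‖ + ‖ z n -ᶜ l ‖     ≤⟨ +-mono-≤ (q n) (p n) ⟩
      K * ½ ^ n + C * ½ ^ n             ≈⟨ distribʳ _ K C ⟨
      (K + C) * ½ ^ n                   ∎

    ⇝-cong : ∀ {z w l} → z ⇝ l → (∀ n → w n ≈ᶜ z n) → w ⇝ l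
    ⇝-cong {l = l} (C , p) q =
      C , λ n → ≤-trans (≈⇒≤ (‖‖-cong (ℂᵣ.+-congʳ {x = -ᶜ l} (q n)))) (p n)

    z-w≈0⇒z≈w : ∀ {z w} → z -ᶜ w ≈ᶜ 0ᶜ → z ≈ᶜ w
    z-w≈0⇒z≈w {z} {w} p = ℂᵣ.trans (solveᶜ 2 (λ z w → z ⊜ z ⊖ w ⊕ w) ℂᵣ.refl z w)
      (ℂᵣ.trans (ℂᵣ.+-congʳ {x = w} p) (ℂᵣ.+-identityˡ w))

    ⇝-unique : ∀ {z l m} → z ⇝ l → z ⇝ m → l ≈ᶜ m
    ⇝-unique {z} {l} {m} (C , p) (D , q) = z-w≈0⇒z≈w (‖z‖≤0⇒z≈0 (≤geometric⇒≤0 (C + D) λ n → begin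
      ‖ l -ᶜ m ‖                        ≤⟨ ‖z-v‖≤‖z-w‖+‖w-v‖ l (z n) m ⟩
      ‖ l -ᶜ z n ‖ + ‖ z n -ᶜ m ‖       ≤⟨ +-mono-≤ (≤-trans (‖z-w‖≤‖w-z‖ l (z n)) (p n)) (q n) ⟩
      C * ½ ^ n + D * ½ ^ n             ≈⟨ distribʳ _ C D ⟨
      (C + D) * ½ ^ n                   ∎))

    ⇝-* : ∀ {z w l m} → z ⇝ l → w ⇝ m → (λ n → z n *ᶜ w n) ⇝ l *ᶜ m
    ⇝-* {z} {w} {l} {m} (C , p) (D , q) = C * D + C * ‖ m ‖ + ‖ l ‖ * D , λ n → begin
      ‖ z n *ᶜ w n -ᶜ l *ᶜ m ‖
        ≈⟨ ‖‖-cong (solveᶜ 4 (λ z w l m → z ⊗ w ⊖ l ⊗ m ⊜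
             (z ⊖ l) ⊗ (w ⊖ m) ⊕ (z ⊖ l) ⊗ m ⊕ l ⊗ (w ⊖ m)) ℂᵣ.refl (z n) (w n) l m) ⟩
      ‖ (z n -ᶜ l) *ᶜ (w n -ᶜ m) +ᶜ (z n -ᶜ l) *ᶜ m +ᶜ l *ᶜ (w n -ᶜ m) ‖
        ≤⟨ ≤-trans (‖z+w‖≤‖z‖+‖w‖ _ _) (+-monoˡ-≤ _ (‖z+w‖≤‖z‖+‖w‖ _ _)) ⟩
      ‖ (z n -ᶜ l) *ᶜ (w n -ᶜ m) ‖ + ‖ (z n -ᶜ l) *ᶜ m ‖ + ‖ l *ᶜ (w n -ᶜ m) ‖
        ≤⟨ +-mono-≤ (+-mono-≤ (‖z*w‖≤‖z‖*‖w‖ _ _) (‖z*w‖≤‖z‖*‖w‖ _ _)) (‖z*w‖≤‖z‖*‖w‖ _ _) ⟩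
      ‖ z n -ᶜ l ‖ * ‖ w n -ᶜ m ‖ + ‖ z n -ᶜ l ‖ * ‖ m ‖ + ‖ l ‖ * ‖ w n -ᶜ m ‖
        ≤⟨ +-mono-≤ (+-mono-≤
             (*-mono-≤ (0≤‖z‖ _) (≤-trans (0≤‖z‖ _) (p n)) (p n) (≤-trans (q n) (D½ⁿ≤D n)))
             (*-monoʳ-≤ (0≤‖z‖ m) (p n))) (*-monoˡ-≤ (0≤‖z‖ l) (q n)) ⟩
      C * ½ ^ n * D + C * ½ ^ n * ‖ m ‖ + ‖ l ‖ * (D * ½ ^ n)
        ≈⟨ solve 5 (λ c d p m l → c :* p :* d :+ c :* p :* m :+ l :* (d :* p) :=
             (c :* d :+ c :* m :+ l :* d) :* p) refl C D (½ ^ n) (‖ m ‖) (‖ l ‖) ⟩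
      (C * D + C * ‖ m ‖ + ‖ l ‖ * D) * ½ ^ n ∎
      where
      0≤D : 0# ≤ D
      0≤D = ≤-trans (0≤‖z‖ _) (≤-trans (q 0) (≈⇒≤ (*-identityʳ D)))
      D½ⁿ≤D : ∀ n → D * ½ ^ n ≤ D
      D½ⁿ≤D n = ≤-trans (*-monoˡ-≤ 0≤D (½^≤1 n)) (≈⇒≤ (*-identityʳ D))

    0≤‖‖-bound : ∀ {C} {a : ℕ → ℂ} → (∀ k → ‖ a k ‖ ≤ C * ½ ^ k) → 0# ≤ C
    0≤‖‖-bound p = ≤-trans (0≤‖z‖ _) (≤-trans (p 0) (≈⇒≤ (*-identityʳ _)))

    -- Induction from the first term: the remaining terms satisfy the hypothesis with C / 2, and C +
    -- 2 (C / 2) = 2 C.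
    ‖Σ‖-bound : ∀ {C} {a : ℕ → ℂ} → (∀ k → ‖ a k ‖ ≤ C * ½ ^ k) → ∀ n → ‖ Σ a n ‖ ≤ C + C
    ‖Σ‖-bound {C} {a} p zero    = ≤-trans (≈⇒≤ ‖0‖≈0) (0≤x+y (0≤‖‖-bound {a = a} p) (0≤‖‖-bound {a = a} p))
    ‖Σ‖-bound {C} {a} p (suc n) = begin
      ‖ a 0 +ᶜ Σ (a ∘ suc) n ‖       ≤⟨ ‖z+w‖≤‖z‖+‖w‖ _ _ ⟩
      ‖ a 0 ‖ + ‖ Σ (a ∘ suc) n ‖    ≤⟨ +-mono-≤ (p 0) (‖Σ‖-bound {½ * C} tail n) ⟩
      C * 1# + (½ * C + ½ * C)       ≈⟨ +-cong (*-identityʳ C) (½*x+½*x≈x C) ⟩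
      C + C                          ∎
      where
      tail : ∀ k → ‖ a (suc k) ‖ ≤ ½ * C * ½ ^ k
      tail k = ≤-trans (p (suc k)) (≈⇒≤ (solve 3 (λ c h p → c :* (h :* p) := h :* c :* p) refl C ½ (½ ^ k)))

    -- The ratio ¼ is what makes the error in defect-bound O(½ⁿ).
    _≼_ : (ℕ → ℂ) → ℝ → Set
    a ≼ C = ∀ k → ‖ a k ‖ ≤ C * (½ ^ k * ½ ^ k)

    0≤≼ : ∀ {C} {a : ℕ → ℂ} → a ≼ C → 0# ≤ C
    0≤≼ p = ≤-trans (0≤‖z‖ _) (≤-trans (p 0) (≈⇒≤ (trans (*-congˡ (*-identityʳ 1#)) (*-identityʳ _))))

    ≼⇒½ : ∀ {C a} → a ≼ C → ∀ k → ‖ a k ‖ ≤ C * ½ ^ k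
    ≼⇒½ {a = a} p k = ≤-trans (p k) (*-monoˡ-≤ (0≤≼ {a = a} p)
      (≤-trans (*-monoˡ-≤ (0≤½^ k) (½^≤1 k)) (≈⇒≤ (*-identityʳ _))))

    ≼-tail : ∀ {C} {a : ℕ → ℂ} → a ≼ C → a ∘ suc ≼ ½ * (½ * C)
    ≼-tail {C} p k = ≤-trans (p (suc k)) (≈⇒≤
      (solve 3 (λ c h p → c :* ((h :* p) :* (h :* p)) := h :* (h :* c) :* (p :* p)) refl C ½ (½ ^ k)))

    -- The shift of `a` replaces C by C / 4. Hence both summands in `defect-suc` are at most 2 (C /
    -- 4) D ½ⁿ, and together at most C D ½ⁿ, which is 2 C D ½ⁿ⁺¹.
    defect-bound : ∀ {C D} {a b : ℕ → ℂ} → a ≼ C → b ≼ D →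
                   ∀ n → ‖ defect a b n ‖ ≤ (C * D + C * D) * ½ ^ n
    defect-bound {C} {D} {a} {b} p q zero = begin
      ‖ 0ᶜ *ᶜ 0ᶜ -ᶜ 0ᶜ ‖
        ≈⟨ ‖‖-cong (ℂᵣ.trans (ℂᵣ.+-congʳ {x = -ᶜ 0ᶜ} (ℂᵣ.zeroˡ 0ᶜ)) (ℂᵣ.-‿inverseʳ 0ᶜ)) ⟩
      ‖ 0ᶜ ‖                    ≈⟨ ‖0‖≈0 ⟩
      0#                        ≤⟨ 0≤x*y (0≤x+y 0≤CD 0≤CD) (0≤½^ 0) ⟩
      (C * D + C * D) * ½ ^ 0   ∎
      where 0≤CD = 0≤x*y (0≤≼ {a = a} p) (0≤≼ {a = b} q)
    defect-bound {C} {D} {a} {b} p q (suc n) = begin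
      ‖ defect a b (suc n) ‖
        ≈⟨ ‖‖-cong (defect-suc a b n) ⟩
      ‖ defect (a ∘ suc) b n +ᶜ Σ (a ∘ suc) n *ᶜ b n ‖
        ≤⟨ ≤-trans (‖z+w‖≤‖z‖+‖w‖ _ _) (+-monoʳ-≤ _ (‖z*w‖≤‖z‖*‖w‖ _ _)) ⟩
      ‖ defect (a ∘ suc) b n ‖ + ‖ Σ (a ∘ suc) n ‖ * ‖ b n ‖
        ≤⟨ +-mono-≤ (defect-bound {C′} {a = a ∘ suc} (≼-tail {a = a} p) q n)
             (*-mono-≤ (0≤‖z‖ _) (≤-trans (0≤‖z‖ _) Σ-bound) Σ-bound (≼⇒½ {a = b} q n)) ⟩
      (C′ * D + C′ * D) * ½ ^ n + (C′ + C′) * (D * ½ ^ n)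
        ≈⟨ solve 4 (λ h c d p → let c′ = h :* (h :* c) in
             (c′ :* d :+ c′ :* d) :* p :+ (c′ :+ c′) :* (d :* p) :=
             (h :+ h) :* ((c :* d :+ c :* d) :* (h :* p))) refl ½ C D (½ ^ n) ⟩
      (½ + ½) * ((C * D + C * D) * ½ ^ suc n)
        ≈⟨ trans (*-congʳ ½+½≈1) (*-identityˡ _) ⟩
      (C * D + C * D) * ½ ^ suc n ∎
      where
      C′ = ½ * (½ * C)
      Σ-bound = ‖Σ‖-bound {a = a ∘ suc} (≼⇒½ {a = a ∘ suc} (≼-tail {a = a} p)) n

    expTerm : ℂ → ℕ → ℂ
    expTerm z k = ι (natural (k !) ⁻¹) *ᶜ z ^ᶜ k

    factorial⁻¹-suc : ∀ n → natural (suc n) * natural (suc n !) ⁻¹ ≈ natural (n !) ⁻¹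
    factorial⁻¹-suc n = begin-equality
      M * I             ≈⟨ *-identityʳ _ ⟨
      M * I * 1#        ≈⟨ *-congˡ (⁻¹-inverseʳ (natural≉0 (ℕ.1≤n! n))) ⟨
      M * I * (F * J)   ≈⟨ solve 4 (λ m i f j → m :* i :* (f :* j) := (m :* f) :* i :* j) refl M I F J ⟩
      (M * F) * I * J   ≈⟨ *-congʳ (*-congʳ (×1-homo-* (suc n) (n !))) ⟨
      natural (suc n !) * I * J   ≈⟨ *-congʳ (⁻¹-inverseʳ (natural≉0 (ℕ.1≤n! (suc n)))) ⟩
      1# * J            ≈⟨ *-identityˡ J ⟩
      J                 ∎
      where
      natural≉0 : ∀ {n} → 1 ℕ.≤ n → natural n ≉ 0#
      natural≉0 (ℕ.s≤s {n = n} _) = >⇒≉ (0<natural n)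
      M = natural (suc n)
      F = natural (n !)
      I = natural (suc n !) ⁻¹
      J = natural (n !) ⁻¹

    expTerm-exponential : ∀ z → Exponential z (expTerm z)
    expTerm-exponential = powerSeries-exponential {λ k → ι (natural (k !) ⁻¹)}
      (ι-cong (begin-equality
        natural 1 ⁻¹               ≈⟨ *-identityˡ _ ⟨
        1# * natural 1 ⁻¹          ≈⟨ *-congʳ (+-identityʳ 1#) ⟨
        natural 1 * natural 1 ⁻¹   ≈⟨ ⁻¹-inverseʳ (>⇒≉ (0<natural 0)) ⟩
        1#                         ∎))
      λ n → ℂᵣ.trans (ι-natural-* (suc n) _) (ι-cong (factorial⁻¹-suc n))

    natural-invertible : ∀ n → ∃ λ w → suc n ·ᶜ 1ᶜ *ᶜ w ≈ᶜ 1ᶜ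
    natural-invertible n = ι (natural (suc n) ⁻¹) ,
      ℂᵣ.trans (ι-natural-* (suc n) _) (ι-cong (⁻¹-inverseʳ (>⇒≉ (0<natural n))))

    -- The ratio bound ‖ z ‖ / (n + 1) for successive terms, read off from the recursion.
    natural*‖expTerm-suc‖ : ∀ z n → natural (suc n) * ‖ expTerm z (suc n) ‖ ≤ ‖ z ‖ * ‖ expTerm z n ‖
    natural*‖expTerm-suc‖ z n = begin
      natural (suc n) * ‖ expTerm z (suc n) ‖
        ≤⟨ *‖‖≤‖ι*‖ (expTerm z (suc n)) (0≤natural (suc n)) ⟩
      ‖ ι (natural (suc n)) *ᶜ expTerm z (suc n) ‖
        ≈⟨ ‖‖-cong (ℂᵣ.*-congʳ {x = expTerm z (suc n)} (ι-natural (suc n))) ⟨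
      ‖ ∂ (expTerm z) n ‖                              ≈⟨ ‖‖-cong (proj₂ (expTerm-exponential z) n) ⟩
      ‖ z *ᶜ expTerm z n ‖                             ≤⟨ ‖z*w‖≤‖z‖*‖w‖ z (expTerm z n) ⟩
      ‖ z ‖ * ‖ expTerm z n ‖                          ∎

    eventually-decreasing⇒bounded : ∀ M (g : ℕ → ℝ) → (∀ k → M ℕ.≤ k → g (suc k) ≤ g k) →
                                    ∃ λ C → ∀ k → g k ≤ C
    eventually-decreasing⇒bounded zero g p = g 0 , bound
      where
      bound : ∀ k → g k ≤ g 0
      bound zero    = ≤-refl
      bound (suc k) = ≤-trans (p k ℕ.z≤n) (bound k)
    eventually-decreasing⇒bounded (suc M) g p
      with eventually-decreasing⇒bounded M (g ∘ suc) (λ k q → p (suc k) (ℕ.s≤s q))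
    ... | C , q = g 0 ⊔ C , λ { zero → ⊔.x≤x⊔y _ _ ; (suc k) → ≤-trans (q k) (⊔.x≤y⊔x _ _) }

    -- The sequence g k = 4ᵏ ‖ t k ‖ decreases as soon as k ≥ M, where M exceeds 4 ‖ z ‖, because
    -- the ratio of successive terms is then below ¼. A sequence that decreases from some index on
    -- is bounded.
    expTerm-≼ : ∀ z → ∃ λ C → expTerm z ≼ C
    expTerm-≼ z = C , bound
      where
      d = 1# + 1#
      0≤d² : 0# ≤ d * d
      0≤d² = 0≤x*y (<⇒≤ 0<2) (<⇒≤ 0<2)
      g : ℕ → ℝ
      g k = (d ^ k * d ^ k) * ‖ expTerm z k ‖

      0≤d^ : ∀ k → 0# ≤ d ^ k
      0≤d^ zero    = 0≤1
      0≤d^ (suc k) = 0≤x*y (<⇒≤ 0<2) (0≤d^ k)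

      d^*½^≈1 : ∀ k → d ^ k * ½ ^ k ≈ 1#
      d^*½^≈1 zero    = *-identityʳ 1#
      d^*½^≈1 (suc k) = begin-equality
        d * d ^ k * (½ * ½ ^ k)     ≈⟨ solve 4 (λ d p h q → d :* p :* (h :* q) := (d :* h) :* (p :* q)) refl
                                         d (d ^ k) ½ (½ ^ k) ⟩
        (d * ½) * (d ^ k * ½ ^ k)   ≈⟨ *-cong (⁻¹-inverseʳ (>⇒≉ 0<2)) (d^*½^≈1 k) ⟩
        1# * 1#                     ≈⟨ *-identityʳ 1# ⟩
        1#                          ∎

      M = proj₁ (archimedean (d * d * ‖ z ‖))

      decreasing : ∀ k → M ℕ.≤ k → g (suc k) ≤ g k
      decreasing k M≤k = begin
        (d * d ^ k) * (d * d ^ k) * t′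
          ≈⟨ solve 3 (λ d p t → (d :* p) :* (d :* p) :* t := (p :* p) :* (d :* d :* t)) refl d (d ^ k) t′ ⟩
        (d ^ k * d ^ k) * (d * d * t′)
          ≤⟨ *-monoˡ-≤ (0≤x*y (0≤d^ k) (0≤d^ k)) (*-cancelˡ-≤ (0<natural k) (begin
               natural (suc k) * (d * d * t′)
                 ≈⟨ solve 3 (λ n d t → n :* (d :* t) := d :* (n :* t)) refl _ (d * d) t′ ⟩
               d * d * (natural (suc k) * t′)   ≤⟨ *-monoˡ-≤ 0≤d² (natural*‖expTerm-suc‖ z k) ⟩
               d * d * (‖ z ‖ * t)              ≈⟨ *-assoc _ _ _ ⟨
               d * d * ‖ z ‖ * t                ≤⟨ *-monoʳ-≤ (0≤‖z‖ _) (<⇒≤ (<-≤-trans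
                                                     (proj₂ (archimedean (d * d * ‖ z ‖)))
                                                     (natural-mono-≤ (ℕ.m≤n⇒m≤1+n M≤k)))) ⟩
               natural (suc k) * t              ∎)) ⟩
        (d ^ k * d ^ k) * t ∎
        where
        t  = ‖ expTerm z k ‖
        t′ = ‖ expTerm z (suc k) ‖

      C = proj₁ (eventually-decreasing⇒bounded M g decreasing)

      bound : expTerm z ≼ C
      bound k = begin
        ‖ expTerm z k ‖
          ≈⟨ solve 1 (λ t → t := :1 :* :1 :* t) refl _ ⟩
        1# * 1# * ‖ expTerm z k ‖
          ≈⟨ *-congʳ (*-cong (d^*½^≈1 k) (d^*½^≈1 k)) ⟨
        (d ^ k * ½ ^ k) * (d ^ k * ½ ^ k) * ‖ expTerm z k ‖
          ≈⟨ solve 3 (λ p h t → (p :* h) :* (p :* h) :* t := (p :* p) :* t :* (h :* h)) refl (d ^ k) (½ ^ k) _ ⟩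
        g k * (½ ^ k * ½ ^ k)
          ≤⟨ *-monoʳ-≤ (0≤x*y (0≤½^ k) (0≤½^ k)) (proj₂ (eventually-decreasing⇒bounded M g decreasing) k) ⟩
        C * (½ ^ k * ½ ^ k) ∎

    -- The increments of the partial sums are the terms. So `geometric-limit` applies to the real
    -- and to the imaginary part, and `geometric-lim` identifies the limit found with the `lim` in
    -- the definition of `exp`.
    exp-limit : ∀ z → Σ (expTerm z) ⇝ exp z
    exp-limit z = (C + C) + (C + C) , λ n → begin
      ∣ re (s n) - re (exp z) ∣ + ∣ im (s n) - im (exp z) ∣
        ≤⟨ +-mono-≤ (component re ∣re∣≤‖‖ (λ _ _ → refl) n) (component im ∣im∣≤‖‖ (λ _ _ → refl) n) ⟩
      (C + C) * ½ ^ n + (C + C) * ½ ^ n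
        ≈⟨ distribʳ _ _ _ ⟨
      ((C + C) + (C + C)) * ½ ^ n ∎
      where
      s = Σ (expTerm z)
      C = proj₁ (expTerm-≼ z)

      increment : ∀ n → ‖ s (suc n) -ᶜ s n ‖ ≤ C * ½ ^ n
      increment n = ≤-trans (≈⇒≤ (‖‖-cong (ℂᵣ.trans (ℂᵣ.+-congʳ {x = -ᶜ s n} (Σ-suc (expTerm z) n))
        (solveᶜ 2 (λ s t → s ⊕ t ⊖ s ⊜ t) ℂᵣ.refl (s n) (expTerm z n)))))
        (≼⇒½ {a = expTerm z} (proj₂ (expTerm-≼ z)) n)

      component : ∀ (f : ℂ → ℝ) → (∀ w → ∣ f w ∣ ≤ ‖ w ‖) → (∀ w v → f (w -ᶜ v) ≈ f w - f v) →
                  ∀ n → ∣ f (s n) - lim (λ n → f (s n)) ∣ ≤ (C + C) * ½ ^ n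
      component f f≤ f-sub n = ≤-trans (≈⇒≤ (∣∣-cong (+-congˡ (-‿cong (geometric-lim (C + C) (proj₂ limit))))))
        (proj₂ limit n)
        where
        limit = geometric-limit {λ n → f (s n)} C λ n →
          ≤-trans (≈⇒≤ (∣∣-cong (sym (f-sub (s (suc n)) (s n))))) (≤-trans (f≤ _) (increment n))

    -- The terms for z + w are those of the Cauchy product, since both are exponential sequences for
    -- z + w. Their partial sums thus differ from the products of partial sums by the defect, which
    -- tends to 0.
    exp-+ : ∀ z w → exp (z +ᶜ w) ≈ᶜ exp z *ᶜ exp w
    exp-+ z w = ⇝-unique (exp-limit (z +ᶜ w)) (⇝-transfer (CD + CD) (⇝-* (exp-limit z) (exp-limit w)) close)
      where
      a = expTerm z
      b = expTerm w
      CD = proj₁ (expTerm-≼ z) * proj₁ (expTerm-≼ w)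
      close : ∀ n → ‖ Σ (expTerm (z +ᶜ w)) n -ᶜ Σ a n *ᶜ Σ b n ‖ ≤ (CD + CD) * ½ ^ n
      close n = ≤-trans (≤-trans (‖z-w‖≤‖w-z‖ _ _)
        (≈⇒≤ (‖‖-cong (ℂᵣ.+-congˡ {x = Σ a n *ᶜ Σ b n} (ℂᵣ.-‿cong
          (Σ-cong (exponential-unique natural-invertible (expTerm-exponential (z +ᶜ w))
            (∗-exponential (expTerm-exponential z) (expTerm-exponential w))) n))))))
        (defect-bound {a = a} {b = b} (proj₂ (expTerm-≼ z)) (proj₂ (expTerm-≼ w)) n)

    -- A value chosen by `lim` does not visibly respect `_≈_`; the partial sums do, and limits are
    -- unique.
    exp-cong : ∀ {z w} → z ≈ᶜ w → exp z ≈ᶜ exp w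
    exp-cong {z} {w} p = ⇝-unique (exp-limit z) (⇝-cong (exp-limit w) (Σ-cong λ k →
      ℂᵣ.*-congˡ {x = ι (natural (k !) ⁻¹)} (^ᶜ-congˡ k p)))
      where open SemiringExp ℂᵣ.semiring using () renaming (^-congˡ to ^ᶜ-congˡ)

    -- The quadratic term is at most ‖ z ‖², and from there on each term is at most half of its
    -- predecessor, as ‖ z ‖ ≤ ½. The tail of every partial sum is thus at most 2 ‖ z ‖², and the
    -- bound passes to the limit.
    exp-remainder : ∀ z → ‖ z ‖ ≤ ½ → ‖ exp z -ᶜ (1ᶜ +ᶜ z) ‖ ≤ ‖ z ‖ * ‖ z ‖ + ‖ z ‖ * ‖ z ‖
    exp-remainder z ‖z‖≤½ = 0≤-⇒≤ (≤-trans (≤-trans (≈⇒≤ (sym -0#≈0#)) (neg-mono-≤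
        (≤geometric⇒≤0 C λ n → x-y≤ (begin
          ‖ exp z -ᶜ (1ᶜ +ᶜ z) ‖
            ≤⟨ ‖z-v‖≤‖z-w‖+‖w-v‖ (exp z) (s (suc (suc n))) (1ᶜ +ᶜ z) ⟩
          ‖ exp z -ᶜ s (suc (suc n)) ‖ + ‖ s (suc (suc n)) -ᶜ (1ᶜ +ᶜ z) ‖
            ≤⟨ +-mono-≤ (≤-trans (‖z-w‖≤‖w-z‖ _ _) (≤-trans (proj₂ (exp-limit z) (suc (suc n)))
                 (*-monoˡ-≤ 0≤C (≤-trans (½^suc≤½^ (suc n)) (½^suc≤½^ n)))))
                 (≤-trans (≈⇒≤ (‖‖-cong (exponential-tail (expTerm-exponential z) n)))
                   (‖Σ‖-bound {a = t ∘ suc ∘ suc} tail-bound n)) ⟩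
          C * ½ ^ n + (N * N + N * N) ∎))))
      (≈⇒≤ (solve 2 (λ x y → :- (x :- y) := y :- x) refl _ _)))
      where
      N = ‖ z ‖
      t = expTerm z
      s = Σ t
      C = proj₁ (exp-limit z)
      0≤C : 0# ≤ C
      0≤C = 0≤‖‖-bound {a = λ n → s n -ᶜ exp z} (proj₂ (exp-limit z))

      x-y≤ : ∀ {x y u} → x ≤ u + y → x - y ≤ u
      x-y≤ {x} {y} {u} p = ≤-trans (+-monoˡ-≤ (- y) p) (≈⇒≤ (solve 2 (λ u y → u :+ y :- y := u) refl u y))

      ‖t-suc‖ : ∀ n → ‖ t (suc n) ‖ ≤ N * ‖ t n ‖
      ‖t-suc‖ n = begin
        ‖ t (suc n) ‖                     ≤⟨ x≤x+y (0≤x*y (0≤natural n) (0≤‖z‖ _)) ⟩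
        ‖ t (suc n) ‖ + natural n * ‖ t (suc n) ‖
          ≈⟨ solve 2 (λ n x → x :+ n :* x := (:1 :+ n) :* x) refl (natural n) (‖ t (suc n) ‖) ⟩
        natural (suc n) * ‖ t (suc n) ‖   ≤⟨ natural*‖expTerm-suc‖ z n ⟩
        N * ‖ t n ‖                       ∎

      tail-bound : ∀ k → ‖ t (suc (suc k)) ‖ ≤ N * N * ½ ^ k
      tail-bound zero    = begin
        ‖ t 2 ‖         ≤⟨ ‖t-suc‖ 1 ⟩
        N * ‖ t 1 ‖     ≈⟨ *-congˡ (‖‖-cong (exponential-1 (expTerm-exponential z))) ⟩
        N * N           ≈⟨ *-identityʳ _ ⟨
        N * N * 1#      ∎
      tail-bound (suc k) = begin
        ‖ t (suc (suc (suc k))) ‖    ≤⟨ ‖t-suc‖ (suc (suc k)) ⟩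
        N * ‖ t (suc (suc k)) ‖      ≤⟨ *-mono-≤ (0≤‖z‖ _) (<⇒≤ 0<½) ‖z‖≤½ (tail-bound k) ⟩
        ½ * (N * N * ½ ^ k)
          ≈⟨ solve 3 (λ h n p → h :* (n :* p) := n :* (h :* p)) refl ½ (N * N) (½ ^ k) ⟩
        N * N * ½ ^ suc k            ∎

  -- Continuity, intermediate values and roots

  module ContinuousFunctions where

    open OrderedField
    open GeometricConvergence

    -- Both cos and the powers admit a bound of this kind. The radius ½ is the range on which
    -- `cis-near-1` holds.
    LocallyLipschitz : (ℝ → ℝ) → Set
    LocallyLipschitz F = ∀ x → ∃ λ M → ∀ y → ∣ y - x ∣ ≤ ½ → ∣ F y - F x ∣ ≤ M * ∣ y - x ∣

    continuous : ∀ {F} → LocallyLipschitz F → ∀ x {ε} → 0# < ε →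
                 ∃ λ δ → 0# < δ × (∀ y → ∣ y - x ∣ ≤ δ → ∣ F y - F x ∣ < ε)
    continuous {F} lip x {ε} 0<ε = case lip x of λ (M , bound) →
      -- One more halving than N keeps δ within the radius ½; ∣ M ∣ stands in for M, whose sign is
      -- not known.
      case geometric-null ∣ M ∣ 0<ε of λ (N , small) → ½ ^ suc N , 0<½^ (suc N) , λ y near → begin-strict
      ∣ F y - F x ∣
        ≤⟨ bound y (≤-trans near (≤-trans (*-monoˡ-≤ (<⇒≤ 0<½) (½^≤1 N)) (≈⇒≤ (*-identityʳ ½)))) ⟩
      M * ∣ y - x ∣        ≤⟨ *-mono-≤ (0≤∣x∣ _) (0≤∣x∣ M) (x≤∣x∣ M) near ⟩
      ∣ M ∣ * ½ ^ suc N    <⟨ small (suc N) (ℕ.n≤1+n N) ⟩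
      ε                    ∎

    positive-near : ∀ {F} → LocallyLipschitz F → ∀ {x} → 0# < F x →
                    ∃ λ δ → 0# < δ × (∀ y → ∣ y - x ∣ ≤ δ → 0# < F y)
    positive-near {F} lip {x} 0<Fx = case continuous lip x 0<Fx of λ (δ , 0<δ , close) →
      δ , 0<δ , λ y near → <-≤-trans (<⇒0<- (≤-<-trans (-x≤∣x∣ _) (close y near)))
        (≈⇒≤ (solve 2 (λ u x → x :- :- (u :- x) := u) refl (F y) (F x)))

    neg-lipschitz : ∀ {F} → LocallyLipschitz F → LocallyLipschitz (λ x → - F x)
    neg-lipschitz {F} lip x = proj₁ (lip x) , λ y p → ≤-trans
      (≤-trans (≈⇒≤ (∣∣-cong (solve 2 (λ u v → :- u :- :- v := :- (u :- v)) refl (F y) (F x)))) (∣-x∣≤∣x∣ _))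
      (proj₂ (lip x) y p)

    ≈⇒near : ∀ {x y δ} → 0# < δ → y ≈ x → ∣ y - x ∣ ≤ δ
    ≈⇒near {x} {y} 0<δ p = ≤-trans
      (≈⇒≤ (trans (∣∣-cong (trans (+-congʳ p) (-‿inverseʳ x))) (∣x∣≈x ≤-refl))) (<⇒≤ 0<δ)

    -- s is the supremum of the points of [0, b] where F is positive. If F s > 0, then F is positive
    -- beyond s, or as far as b, where it is negative. If F s < 0, then some s - δ is already an
    -- upper bound.
    intermediateValue : ∀ {F} → LocallyLipschitz F → ∀ {b} → 0# ≤ b → 0# < F 0# → F b < 0# →
                        ∃ λ s → 0# < s × s < b × F s ≈ 0#
    intermediateValue {F} lip {b} 0≤b 0<F0 Fb<0 = s , 0<s , s<b , Fs≈0
      where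
      P : ℝ → Set
      P y = (0# ≤ y × y ≤ b) × 0# < F y

      supremum = complete P (0# , (≤-refl , 0≤b) , 0<F0) (b , λ p → proj₂ (proj₁ p))
      s = proj₁ supremum
      upper = proj₁ (proj₂ supremum)
      least = proj₂ (proj₂ supremum)

      0≤s : 0# ≤ s
      0≤s = upper ((≤-refl , 0≤b) , 0<F0)
      s≤b : s ≤ b
      s≤b = least λ p → proj₂ (proj₁ p)

      s+δ-s≈δ : ∀ δ → s + δ - s ≈ δ
      s+δ-s≈δ δ = solve 2 (λ s d → s :+ d :- s := d) refl s δ

      positive⇒⊥ : ¬ 0# < F s
      positive⇒⊥ 0<Fs = case positive-near lip 0<Fs of λ (δ , 0<δ , near) → case total (s + δ) b of λ where
        (inj₁ s+δ≤b) → ≤⇒≯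
          (upper ((≤-trans 0≤s (x≤x+y (<⇒≤ 0<δ)) , s+δ≤b) ,
            near (s + δ) (≈⇒≤ (trans (∣∣-cong (s+δ-s≈δ δ)) (∣x∣≈x (<⇒≤ 0<δ))))))
          (x<x+y 0<δ)
        (inj₂ b≤s+δ) → <-asym Fb<0 (near b (≤-trans (≈⇒≤ (∣x∣≈x (≤⇒0≤- s≤b)))
          (≤-trans (+-monoˡ-≤ (- s) b≤s+δ) (≈⇒≤ (s+δ-s≈δ δ)))))

      negative⇒⊥ : ¬ F s < 0#
      negative⇒⊥ Fs<0 = case positive-near (neg-lipschitz lip) (<0⇒0<- Fs<0) of λ (δ , 0<δ , near) →
        ≤⇒≯ (least λ {y} p → ≮⇒≥ λ s-δ<y → <-asym (proj₂ p)
            (0<-⇒< (<-respʳ-≈ (sym (+-identityˡ _)) (near y (∣x∣-least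
              (≤-trans (≤-trans (+-monoˡ-≤ (- s) (upper p)) (≈⇒≤ (-‿inverseʳ s))) (<⇒≤ 0<δ))
              (≤-trans (neg-mono-≤ (+-monoˡ-≤ (- s) (<⇒≤ s-δ<y)))
                (≈⇒≤ (solve 2 (λ s d → :- (s :- d :- s) := d) refl s δ))))))))
          (<-≤-trans (x<x+y 0<δ) (≈⇒≤ (solve 2 (λ s d → s :- d :+ d := s) refl s δ)))

      Fs≈0 : F s ≈ 0#
      Fs≈0 = ≤-antisym (≮⇒≥ positive⇒⊥) (≮⇒≥ negative⇒⊥)

      0<s : 0# < s
      0<s = case 0≤s of λ where
        (inj₁ p) → p
        (inj₂ p) → case positive-near lip 0<F0 of λ (δ , 0<δ , near) →
          ⊥-elim (positive⇒⊥ (near s (≈⇒near 0<δ (sym p))))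

      s<b : s < b
      s<b = case s≤b of λ where
        (inj₁ p) → p
        (inj₂ p) → case positive-near (neg-lipschitz lip) (<0⇒0<- Fb<0) of λ (δ , 0<δ , near) →
          ⊥-elim (>⇒≉ (near s (≈⇒near 0<δ p)) (trans (-‿cong Fs≈0) -0#≈0#))

    0≤x^n : ∀ {x} → 0# ≤ x → ∀ n → 0# ≤ x ^ n
    0≤x^n p zero    = 0≤1
    0≤x^n p (suc n) = 0≤x*y p (0≤x^n p n)

    0<x^n : ∀ {x} → 0# < x → ∀ n → 0# < x ^ n
    0<x^n p zero    = 0<1
    0<x^n p (suc n) = *-positive p (0<x^n p n)

    ^-monoˡ-≤ : ∀ {x y} → 0# ≤ x → x ≤ y → ∀ n → x ^ n ≤ y ^ n
    ^-monoˡ-≤ p q zero    = ≤-refl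
    ^-monoˡ-≤ p q (suc n) = *-mono-≤ (0≤x^n p n) (≤-trans p q) q (^-monoˡ-≤ p q n)

    1≤x^n : ∀ {x} → 1# ≤ x → ∀ n → 1# ≤ x ^ n
    1≤x^n p zero    = ≤-refl
    1≤x^n {x} p (suc n) = ≤-trans (≈⇒≤ (sym (*-identityʳ 1#))) (*-mono-≤ 0≤1 (≤-trans 0≤1 p) p (1≤x^n p n))

    ^-lipschitz : ∀ n → LocallyLipschitz (_^ n)
    ^-lipschitz zero    x = 0# , λ y _ →
      ≈⇒≤ (trans (trans (∣∣-cong (-‿inverseʳ 1#)) (∣x∣≈x ≤-refl)) (sym (zeroˡ _)))
    ^-lipschitz (suc n) x = case ^-lipschitz n x of λ (M , lip) →
      (∣ x ∣ + 1#) * M + ∣ x ^ n ∣ , λ y near → begin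
      ∣ y * y ^ n - x * x ^ n ∣
        ≈⟨ ∣∣-cong (solve 4 (λ x y p q → y :* q :- x :* p := y :* (q :- p) :+ p :* (y :- x)) refl
             x y (x ^ n) (y ^ n)) ⟩
      ∣ y * (y ^ n - x ^ n) + x ^ n * (y - x) ∣
        ≤⟨ ≤-trans (∣x+y∣≤∣x∣+∣y∣ _ _) (+-mono-≤ (∣x*y∣≤∣x∣*∣y∣ _ _) (∣x*y∣≤∣x∣*∣y∣ _ _)) ⟩
      ∣ y ∣ * ∣ y ^ n - x ^ n ∣ + ∣ x ^ n ∣ * ∣ y - x ∣
        ≤⟨ +-monoˡ-≤ _ (*-mono-≤ (0≤∣x∣ _) (0≤x+y (0≤∣x∣ x) 0≤1) (∣y∣≤ y near) (lip y near)) ⟩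
      (∣ x ∣ + 1#) * (M * ∣ y - x ∣) + ∣ x ^ n ∣ * ∣ y - x ∣
        ≈⟨ solve 4 (λ a m d b → a :* (m :* d) :+ b :* d := (a :* m :+ b) :* d) refl
             (∣ x ∣ + 1#) M (∣ y - x ∣) (∣ x ^ n ∣) ⟩
      ((∣ x ∣ + 1#) * M + ∣ x ^ n ∣) * ∣ y - x ∣ ∎
      where
      ∣y∣≤ : ∀ y → ∣ y - x ∣ ≤ ½ → ∣ y ∣ ≤ ∣ x ∣ + 1#
      ∣y∣≤ y near = begin
        ∣ y ∣               ≈⟨ ∣∣-cong (solve 2 (λ x y → y := x :+ (y :- x)) refl x y) ⟩
        ∣ x + (y - x) ∣     ≤⟨ ∣x+y∣≤∣x∣+∣y∣ _ _ ⟩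
        ∣ x ∣ + ∣ y - x ∣   ≤⟨ +-monoʳ-≤ _ (≤-trans near (≤-trans (x≤x+y (<⇒≤ 0<½)) (≈⇒≤ ½+½≈1))) ⟩
        ∣ x ∣ + 1#          ∎

    root-exists : ∀ m {x} → 1 ℕ.≤ m → 0# ≤ x → ∃ λ y → 0# ≤ y × y ^ m ≈ x
    root-exists (suc m) {x} _ (inj₂ 0≈x) = 0# , ≤-refl , trans (zeroˡ _) 0≈x
    root-exists (suc m) {x} _ (inj₁ 0<x) =
      -- The search interval is [0, 1 + x]: a positive power of 1 + x is at least 1 + x, hence
      -- greater than x.
      case intermediateValue {λ y → x - y ^ suc m} lip (0≤x+y 0≤1 (<⇒≤ 0<x)) 0<F0 Fb<0 of
        λ (y , 0<y , _ , p) → y , <⇒≤ 0<y , sym (begin-equality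
          x                            ≈⟨ solve 2 (λ x p → x := x :- p :+ p) refl x (y ^ suc m) ⟩
          x - y ^ suc m + y ^ suc m    ≈⟨ +-congʳ p ⟩
          0# + y ^ suc m               ≈⟨ +-identityˡ _ ⟩
          y ^ suc m                    ∎)
      where
      lip : LocallyLipschitz λ y → x - y ^ suc m
      lip z = case ^-lipschitz (suc m) z of λ (M , bound) → M , λ y p → ≤-trans
        (≤-trans (≈⇒≤ (∣∣-cong (solve 3 (λ x u v → x :- u :- (x :- v) := :- (u :- v)) refl
          x (y ^ suc m) (z ^ suc m))))
          (∣-x∣≤∣x∣ _))
        (bound y p)

      0<F0 : 0# < x - 0# ^ suc m
      0<F0 = <-≤-trans 0<x (≈⇒≤ (trans (solve 1 (λ x → x := x :- :0) refl x) (+-congˡ (-‿cong (sym (zeroˡ _))))))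

      Fb<0 : x - (1# + x) ^ suc m < 0#
      Fb<0 = begin-strict
        x - (1# + x) * (1# + x) ^ m   ≤⟨ +-monoʳ-≤ x (neg-mono-≤ (*-monoˡ-≤ (0≤x+y 0≤1 (<⇒≤ 0<x))
                                           (1≤x^n (x≤x+y (<⇒≤ 0<x)) m))) ⟩
        x - (1# + x) * 1#             ≈⟨ solve 1 (λ x → x :- (:1 :+ x) :* :1 := :- :1) refl x ⟩
        - 1#                          <⟨ neg-mono-< 0<1 ⟩
        - 0#                          ≈⟨ -0#≈0# ⟩
        0#                            ∎

    root-spec : ∀ m {x} → 1 ℕ.≤ m → 0# ≤ x → 0# ≤ root m x × root m x ^ m ≈ x
    root-spec m 1≤m 0≤x = the-satisfies (root-exists m 1≤m 0≤x)

  -- Signs of sine and cosine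

  module Trigonometry where

    open OrderedField
    open GeometricConvergence
    open ComplexNumbers
    open ComplexExponential
    open ContinuousFunctions

    sin : ℝ → ℝ
    sin φ = im (cis φ)

    cis-cong : ∀ {φ ψ} → φ ≈ ψ → cis φ ≈ᶜ cis ψ
    cis-cong p = exp-cong (refl , p)

    cis-+ : ∀ φ ψ → cis (φ + ψ) ≈ᶜ cis φ *ᶜ cis ψ
    cis-+ φ ψ = ℂᵣ.trans (exp-cong (sym (+-identityˡ 0#) , refl)) (exp-+ (0# +i φ) (0# +i ψ))

    ‖0+iφ‖ : ∀ φ → ‖ 0# +i φ ‖ ≈ ∣ φ ∣
    ‖0+iφ‖ φ = trans (+-congʳ (∣x∣≈x ≤-refl)) (+-identityˡ _)

    cis-remainder : ∀ φ → ∣ φ ∣ ≤ ½ → ‖ cis φ -ᶜ (1ᶜ +ᶜ 0# +i φ) ‖ ≤ ∣ φ ∣ * ∣ φ ∣ + ∣ φ ∣ * ∣ φ ∣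
    cis-remainder φ ∣φ∣≤½ = ≤-trans
      (exp-remainder (0# +i φ) (≤-trans (≈⇒≤ (‖0+iφ‖ φ)) ∣φ∣≤½))
      (≈⇒≤ (+-cong (*-cong (‖0+iφ‖ φ) (‖0+iφ‖ φ)) (*-cong (‖0+iφ‖ φ) (‖0+iφ‖ φ))))

    2x²≤x : ∀ {x} → 0# ≤ x → x ≤ ½ → x * x + x * x ≤ x
    2x²≤x {x} 0≤x x≤½ = ≤-trans (+-mono-≤ (*-monoʳ-≤ 0≤x x≤½) (*-monoʳ-≤ 0≤x x≤½)) (≈⇒≤ (½*x+½*x≈x x))

    cis-near-1 : ∀ φ → ∣ φ ∣ ≤ ½ → ‖ cis φ -ᶜ 1ᶜ ‖ ≤ ∣ φ ∣ + ∣ φ ∣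
    cis-near-1 φ ∣φ∣≤½ = begin
      ‖ cis φ -ᶜ 1ᶜ ‖
        ≤⟨ ‖z-v‖≤‖z-w‖+‖w-v‖ (cis φ) (1ᶜ +ᶜ 0# +i φ) 1ᶜ ⟩
      ‖ cis φ -ᶜ (1ᶜ +ᶜ 0# +i φ) ‖ + ‖ (1ᶜ +ᶜ 0# +i φ) -ᶜ 1ᶜ ‖
        ≤⟨ +-mono-≤ (≤-trans (cis-remainder φ ∣φ∣≤½) (2x²≤x (0≤∣x∣ φ) ∣φ∣≤½))
             (≈⇒≤ (trans (‖‖-cong (solveᶜ 2 (λ u z → u ⊕ z ⊖ u ⊜ z) ℂᵣ.refl 1ᶜ (0# +i φ))) (‖0+iφ‖ φ))) ⟩
      ∣ φ ∣ + ∣ φ ∣ ∎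

    cis-0 : ∀ {φ} → φ ≈ 0# → cis φ ≈ᶜ 1ᶜ
    cis-0 {φ} p = z-w≈0⇒z≈w (‖z‖≤0⇒z≈0 (≤-trans
      (cis-near-1 φ (≤-trans (≈⇒≤ ∣φ∣≈0) (<⇒≤ 0<½)))
      (≈⇒≤ (trans (+-cong ∣φ∣≈0 ∣φ∣≈0) (+-identityʳ 0#)))))
      where
      ∣φ∣≈0 : ∣ φ ∣ ≈ 0#
      ∣φ∣≈0 = trans (∣∣-cong p) (∣x∣≈x ≤-refl)

    cis-^ : ∀ φ n → cis φ ^ᶜ n ≈ᶜ cis (natural n * φ)
    cis-^ φ zero    = ℂᵣ.sym (cis-0 (zeroˡ φ))
    cis-^ φ (suc n) = ℂᵣ.trans (ℂᵣ.*-congˡ {x = cis φ} (cis-^ φ n)) (ℂᵣ.sym (ℂᵣ.trans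
      (cis-cong (solve 2 (λ n x → (:1 :+ n) :* x := x :+ n :* x) refl (natural n) φ))
      (cis-+ φ (natural n * φ))))

    -- The addition formula gives cis y - cis x = cis x (cis (y - x) - 1), which moves the estimate
    -- to 0.
    cos-lipschitz : LocallyLipschitz cos
    cos-lipschitz x = ‖ cis x ‖ + ‖ cis x ‖ , λ y near → begin
      ∣ cos y - cos x ∣
        ≤⟨ ∣re∣≤‖‖ (cis y -ᶜ cis x) ⟩
      ‖ cis y -ᶜ cis x ‖
        ≈⟨ ‖‖-cong (ℂᵣ.+-congʳ {x = -ᶜ cis x} (ℂᵣ.trans
             (cis-cong (solve 2 (λ x y → y := x :+ (y :- x)) refl x y)) (cis-+ x (y - x)))) ⟩
      ‖ cis x *ᶜ cis (y - x) -ᶜ cis x ‖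
        ≈⟨ ‖‖-cong (ℂᵣ.trans (ℂᵣ.+-congˡ {x = cis x *ᶜ cis (y - x)} (ℂᵣ.-‿cong (ℂᵣ.sym (ℂᵣ.*-identityʳ (cis x)))))
             (solveᶜ 3 (λ c d u → c ⊗ d ⊖ c ⊗ u ⊜ c ⊗ (d ⊖ u)) ℂᵣ.refl (cis x) (cis (y - x)) 1ᶜ)) ⟩
      ‖ cis x *ᶜ (cis (y - x) -ᶜ 1ᶜ) ‖
        ≤⟨ ‖z*w‖≤‖z‖*‖w‖ _ _ ⟩
      ‖ cis x ‖ * ‖ cis (y - x) -ᶜ 1ᶜ ‖
        ≤⟨ *-monoˡ-≤ (0≤‖z‖ _) (cis-near-1 (y - x) near) ⟩
      ‖ cis x ‖ * (∣ y - x ∣ + ∣ y - x ∣)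
        ≈⟨ solve 2 (λ c d → c :* (d :+ d) := (c :+ c) :* d) refl (‖ cis x ‖) (∣ y - x ∣) ⟩
      (‖ cis x ‖ + ‖ cis x ‖) * ∣ y - x ∣ ∎

    -- The remainder estimate gives x - sin x ≤ 2 x², and 2 x² < x for 0 < x < ½.
    0<sin-small : ∀ {x} → 0# < x → x < ½ → 0# < sin x
    0<sin-small {x} 0<x x<½ = <-≤-trans (<⇒0<- (begin-strict
      x - sin x                      ≈⟨ solve 2 (λ x s → x :- s := :- (s :- (:0 :+ x))) refl x (sin x) ⟩
      - (sin x - (0# + x))           ≤⟨ -x≤∣x∣ _ ⟩
      ∣ sin x - (0# + x) ∣           ≤⟨ ∣im∣≤‖‖ (cis x -ᶜ (1ᶜ +ᶜ 0# +i x)) ⟩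
      ‖ cis x -ᶜ (1ᶜ +ᶜ 0# +i x) ‖   ≤⟨ cis-remainder x (≤-trans (≈⇒≤ ∣x∣≈) (<⇒≤ x<½)) ⟩
      ∣ x ∣ * ∣ x ∣ + ∣ x ∣ * ∣ x ∣   ≈⟨ +-cong (*-cong ∣x∣≈ ∣x∣≈) (*-cong ∣x∣≈ ∣x∣≈) ⟩
      x * x + x * x                  <⟨ +-mono-<-≤ (*-monoˡ-< 0<x x<½) (*-monoˡ-≤ (<⇒≤ 0<x) (<⇒≤ x<½)) ⟩
      x * ½ + x * ½                  ≈⟨ +-cong (*-comm x ½) (*-comm x ½) ⟩
      ½ * x + ½ * x                  ≈⟨ ½*x+½*x≈x x ⟩
      x                              ∎))
      (≈⇒≤ (solve 2 (λ x s → x :- (x :- s) := s) refl x (sin x)))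
      where
      ∣x∣≈ : ∣ x ∣ ≈ x
      ∣x∣≈ = ∣x∣≈x (<⇒≤ 0<x)

    sin-double : ∀ y → sin (y + y) ≈ sin y * cos y + sin y * cos y
    sin-double y = trans (proj₂ (cis-+ y y))
      (solve 2 (λ c s → c :* s :+ s :* c := s :* c :+ s :* c) refl (cos y) (sin y))

    -- The very predicate in the definition of `π`, which therefore unfolds to
    -- `natural 2 * the FirstZeroOfCos`.
    FirstZeroOfCos : ℝ → Set
    FirstZeroOfCos h = 0# < h × cos h ≈ 0# × (∀ x → 0# < x → x < h → cos x ≉ 0#)

    -- Since cos 0 = 1, a negative value at x would force a zero between 0 and x, before the first
    -- one.
    0<cos : ∀ {h} → FirstZeroOfCos h → ∀ {x} → 0# ≤ x → x < h → 0# < cos x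
    0<cos {h} (_ , _ , first) {x} 0≤x x<h = case compare 0# (cos x) of λ where
      (tri< p _ _) → p
      (tri≈ _ p _) → case 0≤x of λ where
        (inj₁ 0<x) → ⊥-elim (first x 0<x x<h (sym p))
        (inj₂ 0≈x) → ⊥-elim (0≉1 (trans p (proj₁ (cis-0 (sym 0≈x)))))
      (tri> _ _ p) →
        case intermediateValue cos-lipschitz 0≤x (<-≤-trans 0<1 (≈⇒≤ (sym (proj₁ (cis-0 refl))))) p of
          λ (s , 0<s , s<x , cos≈0) → ⊥-elim (first s 0<s (<-trans s<x x<h) cos≈0)

    0<sin : ∀ {h} → FirstZeroOfCos h → ∀ {x} → 0# < x → x < h + h → 0# < sin x
    0<sin {h} h-zero {x} 0<x x<2h = case geometric-null x 0<½ of λ (N , small) →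
      halving N 0<x x<2h (small N ℕ.≤-refl)
      where
      -- N counts the halvings that bring x into the range of `0<sin-small`. Half of x lies below h,
      -- where cos is positive, and again below 2h, so the induction continues.
      halving : ∀ N {x} → 0# < x → x < h + h → x * ½ ^ N < ½ → 0# < sin x
      halving zero    0<x x<2h small = 0<sin-small 0<x (≤-<-trans (≈⇒≤ (sym (*-identityʳ _))) small)
      halving (suc N) {x} 0<x x<2h small = <-≤-trans
        (0<x+y 0<sincos (<⇒≤ 0<sincos))
        (≈⇒≤ (trans (sym (sin-double y)) (proj₂ (cis-cong (½*x+½*x≈x x)))))
        where
        y = ½ * x
        0<y = *-positive 0<½ 0<x
        y<h : y < h
        y<h = *-cancelˡ-< (<⇒≤ 0<2) (begin-strict
          (1# + 1#) * (½ * x)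
            ≈⟨ solve 2 (λ h x → (:1 :+ :1) :* (h :* x) := h :* x :+ h :* x) refl ½ x ⟩
          ½ * x + ½ * x         ≈⟨ ½*x+½*x≈x x ⟩
          x                     <⟨ x<2h ⟩
          h + h                 ≈⟨ solve 1 (λ h → h :+ h := (:1 :+ :1) :* h) refl h ⟩
          (1# + 1#) * h         ∎)
        0<sincos = *-positive
          (halving N 0<y (<-trans (½*x<x 0<x) x<2h)
            (≤-<-trans (≈⇒≤ (solve 3 (λ h x p → h :* x :* p := x :* (h :* p)) refl ½ x (½ ^ N))) small))
          (0<cos h-zero (<⇒≤ 0<y) y<h)

    -- If cos had no positive zero, π would be 0# and the hypothesis contradictory.
    <π/n⇒ : ∀ {x n} → 0# ≤ x → 1 ℕ.≤ n → x < π / natural n →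
            ∃ λ h → FirstZeroOfCos h × natural n * x < h + h
    <π/n⇒ {x} {suc n} 0≤x _ x<π/n = case em {∃ FirstZeroOfCos} of λ where
      (yes e) → the FirstZeroOfCos , the-satisfies e , (begin-strict
        natural (suc n) * x                        <⟨ *-monoˡ-< (0<natural n) x<π/n ⟩
        natural (suc n) * (π / natural (suc n))    ≈⟨ /-cancel (0<natural n) ⟩
        π                                          ≈⟨ solve 1 (λ h → (:1 :+ (:1 :+ :0)) :* h := h :+ h) refl _ ⟩
        the FirstZeroOfCos + the FirstZeroOfCos    ∎)
      (no ¬e) → ⊥-elim (≤⇒≯ 0≤x (<-≤-trans x<π/n (≈⇒≤
        (trans (*-congʳ (trans (*-congˡ (the-default ¬e)) (zeroʳ _))) (zeroˡ _)))))

  -- A linear form on the products of powers of w and z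

  module SectorForms where

    open OrderedField
    open ComplexNumbers
    open ComplexExponential
    open ContinuousFunctions
    open Trigonometry
    open CommutativeSemiringExp ℂᵣ.commutativeSemiring using () renaming (^-distrib-* to ^ᶜ-distrib-*)

    form : ℝ → ℝ → ℂ → ℝ
    form α β z = α * re z + β * im z

    form-cong : ∀ α β {z w} → z ≈ᶜ w → form α β z ≈ form α β w
    form-cong α β (p , q) = +-cong (*-congˡ p) (*-congˡ q)

    form-+ : ∀ α β z w → form α β (z +ᶜ w) ≈ form α β z + form α β w
    form-+ α β (a +i b) (c +i d) = solve 6 (λ α β a b c d →
      α :* (a :+ c) :+ β :* (b :+ d) := (α :* a :+ β :* b) :+ (α :* c :+ β :* d)) refl α β a b c d

    form-ι* : ∀ α β r z → form α β (ι r *ᶜ z) ≈ r * form α β z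
    form-ι* α β r (a +i b) = solve 5 (λ α β r a b →
      α :* (r :* a :- :0 :* b) :+ β :* (r :* b :+ :0 :* a) := r :* (α :* a :+ β :* b)) refl α β r a b

    form-0 : ∀ α β → form α β 0ᶜ ≈ 0#
    form-0 α β = solve 2 (λ α β → α :* :0 :+ β :* :0 := :0) refl α β

    form-sum : ∀ α β n (f : Fin n → ℂ) → form α β (sumᶜ f) ≈ sum λ i → form α β (f i)
    form-sum α β zero    f = form-0 α β
    form-sum α β (suc n) f = trans (form-+ α β _ _) (+-congˡ (form-sum α β n (λ i → f (Fin.suc i))))

    ι-^ : ∀ x n → ι x ^ᶜ n ≈ᶜ ι (x ^ n)
    ι-^ x zero    = ℂᵣ.refl
    ι-^ x (suc n) = ℂᵣ.trans (ℂᵣ.*-congˡ {x = ι x} (ι-^ x n)) (ℂᵣ.sym (ι-* x (x ^ n)))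

    -- The inverse of w is its conjugate divided by c² + d², and this factor is cleared first. The
    -- lemma takes the place of the oddness of sine, cis (- x) being the inverse of cis x.
    im-inverse<0 : ∀ {z w} → z *ᶜ w ≈ᶜ 1ᶜ → 0# < im w → im z < 0#
    im-inverse<0 {a +i b} {c +i d} (p , q) 0<d = *-cancelˡ-< 0≤r (begin-strict
      (c * c + d * d) * b
        ≈⟨ solve 4 (λ a b c d → (c :* c :+ d :* d) :* b := c :* (a :* d :+ b :* c) :- d :* (a :* c :- b :* d))
             refl a b c d ⟩
      c * (a * d + b * c) - d * (a * c - b * d)
        ≈⟨ +-cong (*-congˡ q) (-‿cong (*-congˡ p)) ⟩
      c * 0# - d * 1#
        ≈⟨ solve 2 (λ c d → c :* :0 :- d :* :1 := :- d) refl c d ⟩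
      - d
        <⟨ neg-mono-< 0<d ⟩
      - 0#
        ≈⟨ trans -0#≈0# (sym (zeroʳ _)) ⟩
      (c * c + d * d) * 0# ∎)
      where
      0≤r : 0# ≤ c * c + d * d
      0≤r = 0≤x+y (0≤x² c) (0≤x² d)

    0<sin-multiple : ∀ {n φ} → 0# < φ → φ < π / natural n → ∀ {k} → 1 ℕ.≤ k → k ℕ.≤ n →
                     0# < sin (natural k * φ)
    0<sin-multiple {n} {φ} 0<φ φ<π/n {suc k} 1≤k k≤n =
      case <π/n⇒ {n = n} (<⇒≤ 0<φ) (ℕ.≤-trans 1≤k k≤n) φ<π/n of λ (h , h-zero , nφ<2h) →
        0<sin h-zero (*-positive (0<natural k) 0<φ)
          (≤-<-trans (*-monoʳ-≤ (<⇒≤ 0<φ) (natural-mono-≤ k≤n)) nφ<2h)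

    NonnegativeUpTo : ℕ → ℝ → ℝ → (ℕ → ℂ) → Set
    NonnegativeUpTo n α β w = (∀ k → k ℕ.≤ n → 0# ≤ form α β (w k)) × 0# < form α β (w n)

    -- For φ ≠ 0 and 1 ≤ k ≤ n, the angles kφ lie strictly between 0 and π or between - π and 0,
    -- where Im has a fixed sign. For φ = 0, Im vanishes on all the powers, and Re, equal to 1
    -- there, takes its place.
    cis-form : ∀ {n φ} → 1 ℕ.≤ n → ∣ φ ∣ < π / natural n →
               ∃₂ λ α β → NonnegativeUpTo n α β (λ k → cis (natural k * φ))
    cis-form {n} {φ} 1≤n ∣φ∣<π/n = case compare 0# φ of λ where
        (tri≈ _ 0≈φ _) → 1# , 0# , (λ k _ → <⇒≤ (0<re 0≈φ k)) , 0<re 0≈φ n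
        (tri< 0<φ _ _) → 0# , 1# , extend 0# 1# (≈⇒≤ (solve 0 (:0 := :0 :* :1 :+ :1 :* :0) refl)) (0<im 0<φ)
        (tri> _ _ φ<0) → 0# , - 1# ,
          extend 0# (- 1#) (≈⇒≤ (solve 0 (:0 := :0 :* :1 :+ :- :1 :* :0) refl)) (0<-im φ<0)
      where
      u : ℕ → ℂ
      u k = cis (natural k * φ)

      extend : ∀ α β → 0# ≤ form α β 1ᶜ → (∀ k → 1 ℕ.≤ k → k ℕ.≤ n → 0# < form α β (u k)) →
               NonnegativeUpTo n α β u
      extend α β 0≤1-form positive = nonnegative , positive n 1≤n ℕ.≤-refl
        where
        nonnegative : ∀ k → k ℕ.≤ n → 0# ≤ form α β (u k)
        nonnegative zero    _   = ≤-trans 0≤1-form (≈⇒≤ (sym (form-cong α β (cis-0 (zeroˡ φ)))))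
        nonnegative (suc k) k≤n = <⇒≤ (positive (suc k) (ℕ.s≤s ℕ.z≤n) k≤n)

      0<re : 0# ≈ φ → ∀ k → 0# < form 1# 0# (u k)
      0<re 0≈φ k = <-≤-trans 0<1 (≈⇒≤ (trans (solve 0 (:1 := :1 :* :1 :+ :0 :* :0) refl)
        (sym (form-cong 1# 0# (cis-0 (trans (*-congˡ (sym 0≈φ)) (zeroʳ _)))))))

      0<im : 0# < φ → ∀ k → 1 ℕ.≤ k → k ℕ.≤ n → 0# < form 0# 1# (u k)
      0<im 0<φ k 1≤k k≤n = <-≤-trans (0<sin-multiple {n} 0<φ (≤-<-trans (x≤∣x∣ φ) ∣φ∣<π/n) 1≤k k≤n)
        (≈⇒≤ (solve 2 (λ a b → b := :0 :* a :+ :1 :* b) refl (re (u k)) (im (u k))))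

      opposite : ∀ k → u k *ᶜ cis (natural k * - φ) ≈ᶜ 1ᶜ
      opposite k = ℂᵣ.trans (ℂᵣ.sym (cis-+ (natural k * φ) (natural k * - φ)))
        (cis-0 (solve 2 (λ k φ → k :* φ :+ k :* :- φ := :0) refl (natural k) φ))

      0<-im : φ < 0# → ∀ k → 1 ℕ.≤ k → k ℕ.≤ n → 0# < form 0# (- 1#) (u k)
      0<-im φ<0 k 1≤k k≤n = <-≤-trans
        (<0⇒0<- (im-inverse<0 {u k} {cis (natural k * - φ)} (opposite k)
          (0<sin-multiple {n} (<0⇒0<- φ<0) (≤-<-trans (-x≤∣x∣ φ) ∣φ∣<π/n) 1≤k k≤n)))
        (≈⇒≤ (solve 2 (λ a b → :- b := :0 :* a :+ :- :1 :* b) refl (re (u k)) (im (u k))))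

    ray-form : ∀ {n ρ φ} → 1 ℕ.≤ n → 0# < ρ → ∣ φ ∣ < π / natural n →
               ∃₂ λ α β → NonnegativeUpTo n α β ((ι ρ *ᶜ cis φ) ^ᶜ_)
    ray-form {n} {ρ} {φ} 1≤n 0<ρ ∣φ∣<π/n = case cis-form {n} {φ} 1≤n ∣φ∣<π/n of λ (α , β , nonneg , pos) →
      α , β ,
      (λ k k≤n → ≤-trans (0≤x*y (<⇒≤ (0<x^n 0<ρ k)) (nonneg k k≤n)) (≈⇒≤ (sym (scale α β k)))) ,
      <-≤-trans (*-positive (0<x^n 0<ρ n) pos) (≈⇒≤ (sym (scale α β n)))
      where
      scale : ∀ α β k → form α β ((ι ρ *ᶜ cis φ) ^ᶜ k) ≈ ρ ^ k * form α β (cis (natural k * φ))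
      scale α β k = trans (form-cong α β (ℂᵣ.trans (^ᶜ-distrib-* (ι ρ) (cis φ) k)
        (ℂᵣ.*-cong {u = cis φ ^ᶜ k} (ι-^ ρ k) (cis-^ φ k)))) (form-ι* α β (ρ ^ k) _)

    module TranslatedPowers {n α β} {w z : ℂ} {v : ℝ} (w-nonneg : NonnegativeUpTo n α β (w ^ᶜ_))
      (1≤v : 1# ≤ v) (z≈v+w : z ≈ᶜ ι v +ᶜ w) where

      -- The values at the mixed products close the induction: z = v + w leads from wᵏ zᵐ⁺¹ to v wᵏ
      -- zᵐ and wᵏ⁺¹ zᵐ, and neither raises the total degree k + m + 1.
      u : ℕ → ℕ → ℝ
      u k m = form α β (w ^ᶜ k *ᶜ z ^ᶜ m)

      0≤v : 0# ≤ v
      0≤v = ≤-trans 0≤1 1≤v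

      u-zero : ∀ k → u k 0 ≈ form α β (w ^ᶜ k)
      u-zero k = form-cong α β (ℂᵣ.*-identityʳ (w ^ᶜ k))

      u-suc : ∀ k m → u k (suc m) ≈ v * u k m + u (suc k) m
      u-suc k m = trans (form-cong α β (ℂᵣ.trans
          (ℂᵣ.*-congˡ {x = w ^ᶜ k} (ℂᵣ.*-congʳ {x = z ^ᶜ m} z≈v+w))
          (solveᶜ 4 (λ v w p q → p ⊗ ((v ⊕ w) ⊗ q) ⊜ v ⊗ (p ⊗ q) ⊕ (w ⊗ p) ⊗ q) ℂᵣ.refl
            (ι v) w (w ^ᶜ k) (z ^ᶜ m))))
        (trans (form-+ α β _ _) (+-congʳ (form-ι* α β v _)))

      0≤u : ∀ k m → k ℕ.+ m ℕ.≤ n → 0# ≤ u k m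
      0≤u k zero    k≤n = ≤-trans (proj₁ w-nonneg k (≡.subst (ℕ._≤ n) (ℕ.+-identityʳ k) k≤n))
        (≈⇒≤ (sym (u-zero k)))
      0≤u k (suc m) p = ≤-trans (0≤x+y (0≤x*y 0≤v (0≤u k m (ℕ.≤-trans (ℕ.n≤1+n _) q))) (0≤u (suc k) m q))
        (≈⇒≤ (sym (u-suc k m)))
        where q = ≡.subst (ℕ._≤ n) (ℕ.+-suc k m) p

      -- The expansion of wᵏ zᵐ contains wᵏ⁺ᵐ with coefficient 1; for k + m = n this is the power at
      -- which the form is known to be positive.
      0<u : ∀ k m → k ℕ.+ m ≡.≡ n → 0# < u k m
      0<u k zero    p = <-≤-trans (≡.subst (λ k → 0# < form α β (w ^ᶜ k))
          (≡.trans (≡.sym p) (ℕ.+-identityʳ k)) (proj₂ w-nonneg))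
        (≈⇒≤ (sym (u-zero k)))
      0<u k (suc m) p = <-≤-trans
        (≤-<-trans (0≤x*y 0≤v (0≤u k m (ℕ.≤-trans (ℕ.n≤1+n _) (ℕ.≤-reflexive q)))) (begin-strict
          v * u k m                   <⟨ x<x+y (0<u (suc k) m q) ⟩
          v * u k m + u (suc k) m     ∎))
        (≈⇒≤ (sym (u-suc k m)))
        where q = ≡.trans (≡.sym (ℕ.+-suc k m)) p

      height : ℕ → ℝ
      height m = form α β (z ^ᶜ m)

      height≈u : ∀ m → height m ≈ u 0 m
      height≈u m = form-cong α β (ℂᵣ.sym (ℂᵣ.*-identityˡ (z ^ᶜ m)))

      height-suc : ∀ m → height (suc m) ≈ v * height m + u 1 m
      height-suc m = trans (height≈u (suc m)) (trans (u-suc 0 m) (+-congʳ (*-congˡ (sym (height≈u m)))))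

      0≤height : ∀ {m} → m ℕ.≤ n → 0# ≤ height m
      0≤height {m} m≤n = ≤-trans (0≤u 0 m m≤n) (≈⇒≤ (sym (height≈u m)))

      -- Each of the d steps drops a nonnegative summand `u 1 m` from `height-suc`.
      v^*height≤ : ∀ {j k} d → j ℕ.+ d ≡.≡ k → k ℕ.≤ n → v ^ d * height j ≤ height k
      v^*height≤ {j} zero    ≡.refl k≤n = ≈⇒≤ (trans (*-identityˡ _)
        (reflexive (≡.cong height (≡.sym (ℕ.+-identityʳ j)))))
      v^*height≤ {j} (suc d) ≡.refl k≤n = begin
        v * v ^ d * height j                   ≈⟨ *-assoc _ _ _ ⟩
        v * (v ^ d * height j)
          ≤⟨ *-monoˡ-≤ 0≤v (v^*height≤ d ≡.refl (ℕ.≤-trans (ℕ.n≤1+n _) q)) ⟩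
        v * height (j ℕ.+ d)                   ≤⟨ x≤x+y (0≤u 1 (j ℕ.+ d) q) ⟩
        v * height (j ℕ.+ d) + u 1 (j ℕ.+ d)   ≈⟨ height-suc (j ℕ.+ d) ⟨
        height (suc (j ℕ.+ d))                 ≈⟨ reflexive (≡.cong height (≡.sym (ℕ.+-suc j d))) ⟩
        height (j ℕ.+ suc d)                   ∎
        where q = ≡.subst (ℕ._≤ n) (ℕ.+-suc j d) k≤n

      height-mono-≤ : ∀ {j k} → j ℕ.≤ k → k ℕ.≤ n → height j ≤ height k
      height-mono-≤ {j} {k} j≤k k≤n = ≤-trans (≤-trans (≈⇒≤ (sym (*-identityˡ _)))
        (*-monoʳ-≤ (0≤height (ℕ.≤-trans j≤k k≤n)) (1≤x^n 1≤v (k ℕ.∸ j))))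
        (v^*height≤ (k ℕ.∸ j) (ℕ.m+[n∸m]≡n j≤k) k≤n)

      -- Strictness comes from the step n - 1 to n alone: there the summand `u 1 (n - 1)` has total
      -- degree n and is positive.
      height<height-n : ∀ {k} → k ℕ.< n → height k < height n
      height<height-n {k} (ℕ.s≤s {n = m} k≤m) = begin-strict
        height k                ≤⟨ height-mono-≤ k≤m (ℕ.n≤1+n m) ⟩
        height m                ≈⟨ *-identityˡ _ ⟨
        1# * height m           ≤⟨ *-monoʳ-≤ (0≤height (ℕ.n≤1+n m)) 1≤v ⟩
        v * height m            <⟨ x<x+y (0<u 1 m ≡.refl) ⟩
        v * height m + u 1 m    ≈⟨ height-suc m ⟨
        height (suc m)          ∎

  -- Comparison of the coefficients by sign

  module PolynomialSigns where

    open OrderedField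
    open ComplexNumbers
    open ContinuousFunctions
    open SectorForms
    open SortedLists

    sum-allFin : ∀ {n} (f : Fin n → ℝ) → foldr _+_ 0# (map f (allFin n)) ≡ sum f
    sum-allFin {n} f = ≡.trans (≡.cong (foldr _+_ 0#) (List.map-tabulate (λ i → i) f)) (sum-tabulate f)
      where
      sum-tabulate : ∀ {n} (f : Fin n → ℝ) → foldr _+_ 0# (tabulate f) ≡ sum f
      sum-tabulate {zero}  f = ≡.refl
      sum-tabulate {suc n} f = ≡.cong (λ s → f Fin.zero + s) (sum-tabulate (λ i → f (Fin.suc i)))

    sum-mono-< : ∀ {n} {f g : Fin (suc n) → ℝ} → (∀ i → f i ≤ g i) →
                 f (fromℕ n) < g (fromℕ n) → sum f < sum g
    sum-mono-< {zero}  p q = +-mono-<-≤ q ≤-refl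
    sum-mono-< {suc n} p q = +-mono-≤-< (p Fin.zero) (sum-mono-< (λ i → p (Fin.suc i)) q)

    module _ {n} (a : Polynomial n) {P Q : Fin (suc n) → Set} (P? : Decidable P) (Q? : Decidable Q)
      (disjoint : ∀ {i} → P i → Q i → ⊥) (H K : ℝ) where

      -- Intended as a lower bound for aᵢ times the height at i: H bounds the heights at negative
      -- coefficients from above, K those at the indices of `positives` from below, and every other
      -- coefficient is nonnegative.
      weight : Fin (suc n) → ℝ
      weight i = if does (P? i) then a i * H else if does (Q? i) then a i * K else 0#

      -- Rewrites S⁻ H + S⁺ K as one sum over all indices, which can be compared termwise with the
      -- value of the form at f(z).
      weighted-filters : ∀ xs → sumOver a (filter P? xs) * H + sumOver a (filter Q? xs) * K ≈
                                foldr _+_ 0# (map weight xs)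
      weighted-filters [] = solve 2 (λ h k → :0 :* h :+ :0 :* k := :0) refl H K
      weighted-filters (x ∷ xs) with weighted-filters xs
      ... | ih with P? x | Q? x
      ...   | yes p | yes q = ⊥-elim (disjoint p q)
      ...   | yes _ | no  _ = trans (solve 5 (λ a s t h k → (a :+ s) :* h :+ t :* k := a :* h :+ (s :* h :+ t :* k))
                                refl (a x) (sumOver a (filter P? xs)) (sumOver a (filter Q? xs)) H K) (+-congˡ ih)
      ...   | no  _ | yes _ = trans (solve 5 (λ a s t h k → s :* h :+ (a :+ t) :* k := a :* k :+ (s :* h :+ t :* k))
                                refl (a x) (sumOver a (filter P? xs)) (sumOver a (filter Q? xs)) H K) (+-congˡ ih)
      ...   | no  _ | no  _ = trans ih (sym (+-identityˡ _))

      weight-elim : ∀ (T : ℝ → Set) i → (P i → T (a i * H)) → (Q i → T (a i * K)) →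
                    (¬ P i → ¬ Q i → T 0#) → T (weight i)
      weight-elim T i p q r with P? i | Q? i
      ... | yes x | _     = p x
      ... | no _  | yes y = q y
      ... | no x  | no y  = r x y

    sumOver-nonneg : ∀ {n} (a : Polynomial n) {xs} → All (λ i → 0# < a i) xs → 0# ≤ sumOver a xs
    sumOver-nonneg a []       = ≤-refl
    sumOver-nonneg a (p ∷ ps) = 0≤x+y (<⇒≤ p) (sumOver-nonneg a ps)

    -- `vertex` branches on `positives a` by a `with`; abstracting the same list here makes it
    -- reduce to the equation for a nonempty list.
    vertex-bounds : ∀ {n} (a : Polynomial n) {k₁ ks} → positives a ≡ k₁ ∷ ks →
      1# ≤ vertex a ×
      (∀ {j} → j ∈ negatives a →
        root (toℕ k₁ ℕ.∸ toℕ j) (∣ sumOver a (negatives a) ∣ / sumOver a (k₁ ∷ ks)) ≤ vertex a)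
    vertex-bounds a eq with positives a
    vertex-bounds a ≡.refl | k₁ ∷ ks = ⊔.x≤x⊔y _ _ , λ j∈ → ≤-trans
      (All.lookup (Extrema.xs≤max totalOrder 0# _) (∈-map⁺ _ j∈)) (⊔.x≤y⊔x _ _)

    module _ {n} (a : Polynomial n) (0<aₙ : 0# < a (fromℕ n))
      {k₁ k₂ ks} (pos≡ : positives a ≡ k₁ ∷ k₂ ∷ ks) where

      Negative Positive : Fin (suc n) → Set
      Negative j = a j < 0#
      Positive k = Maybe.All (Fin._< k) (last (negatives a)) × 0# < a k

      -- These two deciders are the ones inside `negatives` and `positives`, so the filter lemmas
      -- apply to those lists as they are.
      Negative? : Decidable Negative
      Negative? j = a j <? 0#

      Positive? : Decidable Positive
      Positive? k = Maybe.dec (Fin._<? k) (last (negatives a)) ×-dec 0# <? a k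

      allFin-sorted : AllPairs Fin._<_ (allFin (suc n))
      allFin-sorted = AllPairs.tabulate⁺-< λ i<j → i<j

      negatives-sorted : AllPairs Fin._<_ (negatives a)
      negatives-sorted = AllPairs.filter⁺ Negative? allFin-sorted

      positives-sorted : AllPairs Fin._<_ (k₁ ∷ k₂ ∷ ks)
      positives-sorted = ≡.subst (AllPairs Fin._<_) pos≡ (AllPairs.filter⁺ Positive? allFin-sorted)

      negative⇒∈ : ∀ {j} → Negative j → j ∈ negatives a
      negative⇒∈ p = ∈-filter⁺ Negative? (∈-allFin _) p

      ∈⇒negative : ∀ {j} → j ∈ negatives a → Negative j
      ∈⇒negative p = proj₂ (∈-filter⁻ Negative? {xs = allFin (suc n)} p)

      positive⇒∈ : ∀ {k} → Positive k → k ∈ k₁ ∷ k₂ ∷ ks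
      positive⇒∈ p = ≡.subst (_ ∈_) pos≡ (∈-filter⁺ Positive? (∈-allFin _) p)

      all-positive : All Positive (k₁ ∷ k₂ ∷ ks)
      all-positive = ≡.subst (All Positive) pos≡ (All.all-filter Positive? (allFin (suc n)))

      k₁≤ : ∀ {k} → Positive k → k₁ Fin.≤ k
      k₁≤ p = first≤ positives-sorted (positive⇒∈ p)
        where
        first≤ : ∀ {i k is} → AllPairs Fin._<_ (i ∷ is) → k ∈ i ∷ is → i Fin.≤ k
        first≤ _        (here ≡.refl) = ℕ.≤-refl
        first≤ (i< ∷ _) (there k∈)    = ℕ.<⇒≤ (All.lookup i< k∈)

      -- n lies above the last negative index: it is the largest index, and aₙ > 0 excludes
      -- equality.
      leading-positive : Positive (fromℕ n)
      leading-positive = above (last (negatives a)) ≡.refl , 0<aₙ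
        where
        above : ∀ m → last (negatives a) ≡ m → Maybe.All (Fin._< fromℕ n) m
        above nothing  _  = Maybe.nothing
        above (just j) eq = Maybe.just (Fin.≤∧≢⇒< (Fin.≤fromℕ j)
          λ { ≡.refl → <-asym 0<aₙ (∈⇒negative (last-∈ eq)) })

      -- The assumption t ≥ 2 enters here, through k₁ < k₂ ≤ n.
      k₁<n : toℕ k₁ ℕ.< n
      k₁<n = ℕ.<-≤-trans (All.head (AllPairs.head positives-sorted)) (Fin.toℕ≤pred[n] k₂)

      module _ {α β w z} (w-nonneg : NonnegativeUpTo n α β (w ^ᶜ_))
        (z≈v+w : z ≈ᶜ ι (vertex a) +ᶜ w) where

        open TranslatedPowers w-nonneg (proj₁ (vertex-bounds a pos≡)) z≈v+w

        S⁻ S⁺ K : ℝ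
        S⁻ = sumOver a (negatives a)
        S⁺ = sumOver a (k₁ ∷ k₂ ∷ ks)
        K  = height (toℕ k₁)

        0<S⁺ : 0# < S⁺
        0<S⁺ = 0<x+y (proj₂ (All.head all-positive)) (sumOver-nonneg a (All.map proj₂ (All.tail all-positive)))

        k₁≤n : toℕ k₁ ℕ.≤ n
        k₁≤n = ℕ.<⇒≤ k₁<n

        -- v is at least the root r of order d = k₁ - j, so S⁺ vᵈ ≥ S⁺ rᵈ = ∣ S⁻ ∣, while the height
        -- grows by at least the factor vᵈ from j to k₁.
        last-dominated : ∀ {j} → j ∈ negatives a → j Fin.< k₁ → 0# ≤ S⁻ * height (toℕ j) + S⁺ * K
        last-dominated {j} j∈ j<k₁ = ≤-trans (≤⇒0≤- (begin
          - S⁻ * H               ≤⟨ *-monoʳ-≤ 0≤H (-x≤∣x∣ S⁻) ⟩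
          ∣ S⁻ ∣ * H             ≈⟨ *-congʳ (/-cancel 0<S⁺) ⟨
          S⁺ * q * H             ≈⟨ *-congʳ (*-congˡ (proj₂ r-spec)) ⟨
          S⁺ * r ^ d * H         ≤⟨ *-monoʳ-≤ 0≤H (*-monoˡ-≤ (<⇒≤ 0<S⁺)
                                      (^-monoˡ-≤ (proj₁ r-spec) (proj₂ (vertex-bounds a pos≡) j∈) d)) ⟩
          S⁺ * vertex a ^ d * H  ≈⟨ *-assoc _ _ _ ⟩
          S⁺ * (vertex a ^ d * H)
            ≤⟨ *-monoˡ-≤ (<⇒≤ 0<S⁺) (v^*height≤ d (ℕ.m+[n∸m]≡n (ℕ.<⇒≤ j<k₁)) k₁≤n) ⟩
          S⁺ * K                 ∎))
          (≈⇒≤ (solve 3 (λ s h k → k :- :- s :* h := s :* h :+ k) refl S⁻ H (S⁺ * K)))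
          where
          H = height (toℕ j)
          d = toℕ k₁ ℕ.∸ toℕ j
          q = ∣ S⁻ ∣ / S⁺
          r = root d q
          0≤H : 0# ≤ H
          0≤H = 0≤height (ℕ.≤-trans (ℕ.<⇒≤ j<k₁) k₁≤n)
          r-spec = root-spec d {q} (ℕ.m<n⇒0<n∸m j<k₁) (0≤x*y (0≤∣x∣ S⁻) (<⇒≤ (0<⁻¹ 0<S⁺)))

        dominated : ∃ λ H → (∀ {i} → Negative i → height (toℕ i) ≤ H) × 0# ≤ S⁻ * H + S⁺ * K
        dominated = by-last (last (negatives a)) ≡.refl
          where
          by-last : ∀ m → last (negatives a) ≡ m →
                    ∃ λ H → (∀ {i} → Negative i → height (toℕ i) ≤ H) × 0# ≤ S⁻ * H + S⁺ * K
          -- Without negative coefficients H = 0 serves: the bound on heights is vacuous, and only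
          -- S⁺ K ≥ 0 remains.
          by-last nothing eq = 0# ,
            (λ p → case ≡.subst (_ ∈_) (last-nothing eq) (negative⇒∈ p) of λ ()) ,
            ≤-trans (0≤x*y (<⇒≤ 0<S⁺) (0≤height k₁≤n))
              (≈⇒≤ (solve 2 (λ s t → t := s :* :0 :+ t) refl S⁻ (S⁺ * K)))
          by-last (just j) eq = height (toℕ j) , bound , last-dominated (last-∈ eq) j<k₁
            where
            j<k₁ : j Fin.< k₁
            j<k₁ = case ≡.subst (Maybe.All (Fin._< k₁)) eq (proj₁ (All.head all-positive)) of λ where
              (Maybe.just p) → p
            bound : ∀ {i} → Negative i → height (toℕ i) ≤ height (toℕ j)
            bound p = case last-maximum negatives-sorted eq (negative⇒∈ p) of λ where
              (inj₁ ≡.refl) → ≤-refl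
              -- Heights increase with the index, so the last negative index has the largest among
              -- the negative ones.
              (inj₂ i<j)    → height-mono-≤ (ℕ.<⇒≤ i<j) (Fin.toℕ≤pred[n] j)

        eval-form : form α β (eval a z) ≈ sum λ i → a i * height (toℕ i)
        eval-form = trans (form-sum α β (suc n) λ i → ι (a i) *ᶜ z ^ᶜ toℕ i)
          (sum-cong-≋ λ i → form-ι* α β (a i) (z ^ᶜ toℕ i))
          where open SemiringSum semiring using (sum-cong-≋)

        eval-form-positive : 0# < form α β (eval a z)
        eval-form-positive = case dominated of λ (H , height≤H , 0≤S) → <-≤-trans (begin-strict
          0#                                            ≤⟨ 0≤S ⟩
          S⁻ * H + S⁺ * K
            ≈⟨ reflexive (≡.cong (λ xs → S⁻ * H + sumOver a xs * K) pos≡) ⟨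
          S⁻ * H + sumOver a (positives a) * K
            ≈⟨ weighted-filters a Negative? Positive? disjoint H K (allFin (suc n)) ⟩
          foldr _+_ 0# (map (c H) (allFin (suc n)))     ≈⟨ reflexive (sum-allFin (c H)) ⟩
          sum (c H)                                     <⟨ sum-mono-< (c≤ height≤H) c< ⟩
          sum (λ i → a i * height (toℕ i))              ∎)
          (≈⇒≤ (sym eval-form))
          where
          disjoint : ∀ {i} → Negative i → Positive i → ⊥
          disjoint p (_ , q) = <-asym p q

          c : ℝ → Fin (suc n) → ℝ
          c H = weight a Negative? Positive? disjoint H K

          c≤ : ∀ {H} → (∀ {i} → Negative i → height (toℕ i) ≤ H) → ∀ i → c H i ≤ a i * height (toℕ i)
          c≤ {H} height≤H i = weight-elim a Negative? Positive? disjoint H K (_≤ a i * height (toℕ i)) i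
            (λ p → begin
              a i * H                 ≈⟨ solve 2 (λ a h → a :* h := :- (:- a :* h)) refl (a i) H ⟩
              - (- a i * H)           ≤⟨ neg-mono-≤ (*-monoˡ-≤ (<⇒≤ (<0⇒0<- p)) (height≤H p)) ⟩
              - (- a i * height (toℕ i))
                ≈⟨ solve 2 (λ a h → a :* h := :- (:- a :* h)) refl (a i) (height (toℕ i)) ⟨
              a i * height (toℕ i)    ∎)
            (λ q → *-monoˡ-≤ (<⇒≤ (proj₂ q)) (height-mono-≤ {toℕ k₁} {toℕ i} (k₁≤ q) (Fin.toℕ≤pred[n] i)))
            (λ ¬p _ → 0≤x*y (≮⇒≥ ¬p) (0≤height {toℕ i} (Fin.toℕ≤pred[n] i)))

          c< : ∀ {H} → c H (fromℕ n) < a (fromℕ n) * height (toℕ (fromℕ n))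
          c< {H} = weight-elim a Negative? Positive? disjoint H K
            (_< a (fromℕ n) * height (toℕ (fromℕ n))) (fromℕ n)
            (λ p → ⊥-elim (<-asym p 0<aₙ))
            -- The leading coefficient is weighted with the height at k₁, which is strictly below
            -- the height at n.
            (λ _ → *-monoˡ-< 0<aₙ (<-≤-trans (height<height-n k₁<n)
              (≈⇒≤ (reflexive (≡.cong height (≡.sym (Fin.toℕ-fromℕ n)))))))
            (λ _ ¬q → ⊥-elim (¬q leading-positive))

    -- A zero of f would make the positive value of the form vanish. The list `ps` comes with an
    -- equation so that it can be split while `positives a` stays intact inside `vertex a`.
    eval≉0 : ∀ {n} (a : Polynomial n) → 1 ℕ.≤ n → 0# < a (fromℕ n) →
             ∀ ps → positives a ≡ ps → 2 ℕ.≤ length ps →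
             ∀ {z} → Sector (vertex a) (π / natural n) z → eval a z ≉ᶜ 0ᶜ
    eval≉0 a 1≤n 0<aₙ (_ ∷ []) _ (ℕ.s≤s ())
    eval≉0 {n} a 1≤n 0<aₙ (k₁ ∷ k₂ ∷ ks) pos≡ _ (ρ , φ , 0<ρ , ∣φ∣<π/n , z≈v+w) eval≈0 =
      case ray-form {n} {ρ} {φ} 1≤n 0<ρ ∣φ∣<π/n of λ (α , β , w-nonneg) →
        >⇒≉ (eval-form-positive a 0<aₙ pos≡ w-nonneg z≈v+w) (trans (form-cong α β eval≈0) (form-0 α β))

theorem2p9 : (em : ExcludedMiddle 0ℓ) (R : CompleteOrderedField) →
    let open Analysis em R in
    (n : ℕ) → 1 ℕ.≤ n →
    (a : Polynomial n) → 0# < a (fromℕ n) →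
    2 ℕ.≤ length (positives a) →
    (z : ℂ) → Sector (vertex a) (π / natural n) z →
    eval a z ≉ᶜ 0ᶜ
theorem2p9 em R n 1≤n a 0<aₙ 2≤t z =
  PolynomialSigns.eval≉0 em R a 1≤n 0<aₙ (Analysis.positives em R a) ≡.refl 2≤t
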